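{- For every positive integer $k$ there exists a planar graph $G$ of odd-girth $2k+1$ such that $\omega\big(G^{(2k-1)}\big)\geq 2^{2k}$.
   Context: All graphs are finite. The odd-girth of a graph is the length of a shortest odd cycle in it. For a graph $G$ and a positive integer $m$, the $m$-th walk-power $G^{(m)}$ is the graph with vertex set $V(G)$ in which two distinct vertices $x,y$ are adjacent if and only if there is a walk of length exactly $m$ in $G$ connecting $x$ and $y$. $\omega(H)$ denotes the clique number of a graph $H$. -}

module Defs where

open import Data.Fin using (Fin; zero; suc; toℕ; fromℕ; inject₁) renaming (_<_ to _<ᶠ_)
open import Data.Fin.Properties using (any?; _≟_)
open import Data.Fin.Subset using (Subset; _∈_; ∣_∣)
open import Data.Integer using (+_)
open import Data.Nat using (ℕ; zero; suc; _≤_)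
open import Data.Nat.Divisibility using (_∣_)
open import Data.Product using (∃-syntax; _×_; _,_)
open import Data.Rational using (ℚ; 0ℚ; 1ℚ; _/_) renaming (_+_ to _+ʳ_; _*_ to _*ʳ_; _-_ to _-ʳ_; _≤_ to _≤ʳ_)
open import Data.Sum using (_⊎_)
open import Function.Definitions using (Injective)
open import Level using (0ℓ)
open import Relation.Binary using (Rel; Symmetric; Irreflexive; Decidable)
open import Relation.Binary.PropositionalEquality using (_≡_; _≢_; refl; ≢-sym)
open import Relation.Nullary using (¬_)
open import Relation.Nullary.Decidable using (_×-dec_; ¬?; map′)

record Graph : Set₁ where
  field
    order  : ℕ
    Adj    : Rel (Fin order) 0ℓ
    symm   : Symmetric Adj
    irrefl : Irreflexive _≡_ Adj
    adj?   : Decidable Adj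

  Vertex : Set
  Vertex = Fin order

open Graph using (Vertex; Adj)

data Walk (G : Graph) : ℕ → Vertex G → Vertex G → Set where
  []  : ∀ {x} → Walk G zero x x
  _∷_ : ∀ {m x y z} → Adj G x y → Walk G m y z → Walk G (suc m) x z

module _ (G : Graph) where
  open Graph G using (symm; adj?)

  snoc : ∀ {m x y z} → Walk G m x y → Adj G y z → Walk G (suc m) x z
  snoc []      f = f ∷ []
  snoc (e ∷ w) f = e ∷ snoc w f

  reverse : ∀ {m x y} → Walk G m x y → Walk G m y x
  reverse []      = []
  reverse (e ∷ w) = snoc (reverse w) (symm e)

  walk? : ∀ m → Decidable (Walk G m)
  walk? zero    x z = map′ (λ { refl → [] }) (λ { [] → refl }) (x ≟ z)
  walk? (suc m) x z = map′ (λ { (_ , e , w) → e ∷ w }) (λ { (e ∷ w) → _ , e , w })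
                           (any? λ y → adj? x y ×-dec walk? m y z)

  walkPower : ℕ → Graph
  walkPower m = record
    { order  = Graph.order G
    ; Adj    = λ x y → x ≢ y × Walk G m x y
    ; symm   = λ { (x≢y , w) → ≢-sym x≢y , reverse w }
    ; irrefl = λ { x≡y (x≢y , _) → x≢y x≡y }
    ; adj?   = λ x y → ¬? (x ≟ y) ×-dec walk? m x y
    }

data Cycle (G : Graph) : ℕ → Set where
  cycle : ∀ {m} (v : Fin (suc m) → Vertex G) →
          2 ≤ m →
          Injective _≡_ _≡_ v →
          (∀ (i : Fin m) → Adj G (v (inject₁ i)) (v (suc i))) →
          Adj G (v (fromℕ m)) (v zero) →
          Cycle G (suc m)

Odd : ℕ → Set
Odd n = ¬ (2 ∣ n)

IsOddGirth : Graph → ℕ → Set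
IsOddGirth G g = Odd g × Cycle G g × (∀ l → Odd l → Cycle G l → g ≤ l)

IsClique : (H : Graph) → Subset (Graph.order H) → Set
IsClique H S = ∀ x y → x ∈ S → y ∈ S → x ≢ y → Adj H x y

IsCliqueNumber : Graph → ℕ → Set
IsCliqueNumber H w =
  (∃[ S ] IsClique H S × ∣ S ∣ ≡ w) × (∀ S → IsClique H S → ∣ S ∣ ≤ w)

-- A graph is planar if it can be drawn in the plane with polygonal arcs as
-- edges, no edge meeting a vertex or another edge in its interior.  All
-- corners are taken rational.  This loses nothing: a planar graph has a
-- polygonal drawing, whose corners can be perturbed to rational points, and
-- two segments with rational ends that meet in ℝ² meet in a rational point,
-- so disjointness over ℚ is disjointness over ℝ.

Point : Set
Point = ℚ × ℚ

along : Point → Point → ℚ → Point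
along (x , y) (x′ , y′) t = x +ʳ t *ʳ (x′ -ʳ x) , y +ʳ t *ʳ (y′ -ʳ y)

InUnit : ℚ → Set
InUnit t = 0ℚ ≤ʳ t × t ≤ʳ 1ℚ

-- A polygonal arc is the image of a piecewise linear map [0, bends + 1] → ℚ²;
-- `at i t` is its value at the parameter i + t, and `simple` says that it is
-- injective.
record Arc (p q : Point) : Set where
  field
    bends  : ℕ
    corner : Fin (suc (suc bends)) → Point
    start  : corner zero ≡ p
    end    : corner (fromℕ (suc bends)) ≡ q

  at : Fin (suc bends) → ℚ → Point
  at i = along (corner (inject₁ i)) (corner (suc i))

  field
    simple : ∀ i j s t → InUnit s → InUnit t → at i s ≡ at j t →
             (+ toℕ i / 1) +ʳ s ≡ (+ toℕ j / 1) +ʳ t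

_∈ᵃ_ : ∀ {p q} → Point → Arc p q → Set
r ∈ᵃ a = ∃[ i ] ∃[ t ] InUnit t × Arc.at a i t ≡ r

-- Each undirected edge is represented once, by its ends in increasing order;
-- edges are compared by their ends only, not by their adjacency proofs.
record Edge (G : Graph) : Set where
  field
    src tgt : Vertex G
    ordered : src <ᶠ tgt
    adj     : Adj G src tgt

open Edge

record PlaneDrawing (G : Graph) : Set where
  field
    pos     : Vertex G → Point
    pos-inj : Injective _≡_ _≡_ pos
    arc     : (e : Edge G) → Arc (pos (src e)) (pos (tgt e))
    edge-vertex : ∀ e v → pos v ∈ᵃ arc e → v ≡ src e ⊎ v ≡ tgt e
    edge-edge   : ∀ e f → ¬ (src e ≡ src f × tgt e ≡ tgt f) →
                  ∀ r → r ∈ᵃ arc e → r ∈ᵃ arc f →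
                  r ≡ pos (src e) ⊎ r ≡ pos (tgt e)

Planar : Graph → Set
Planar = PlaneDrawing

{-# OPTIONS --safe #-}

-- Let n = 2k + 1.  The projective cube has the vectors of ℤ₂ⁿ⁻¹ as vertices, and
-- its edges flip one coordinate or all of them; an odd closed walk complements an
-- odd number of times and hence has length at least n.  The graph maps to it.
-- A network with poles source and sink has j + 1 of the n colours inside and the
-- remaining d + 1 in a source-sink path outside it (n = j + d + 2).  A network
-- with at least two inside colours consists of two networks with one of them less,
-- left from source to y and right from z to sink, the edges source-z and y-sink,
-- and a path of length d + 1 between y and z.  The outside path, extended by one
-- of the two new edges, serves as the outside path of each half.
--
-- Every label in ℤ₂ʲ⁺¹ belongs to one terminal: those of left start with 0, those
-- of right with 1.  A terminal with a ones and a′ zeros (past the leading bit) in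
-- left and one with b ones and b′ zeros in right are joined by walks of lengths
--   a + 1 + b (via source),        a′ + 1 + b′ (via sink),
--   a + (d + 1) + b′ (outside),    a′ + (d + 1) + b (along y-z),
-- and one of them is odd and at most n - 2.  Closing the network on n - 1 colours
-- by an edge source-sink thus yields 2ⁿ⁻¹ vertices pairwise joined by walks of
-- length n - 2.
--
-- In the drawing all edges are straight.  A network lies in a triangle with its
-- poles as two of the corners, and it meets the two sides through the third
-- corner, the apex, only in the poles.
-- Both y and z are interior points of that triangle on a line through the apex;
-- left is drawn in the triangle source, y, z with apex z, and right in z, sink, y
-- with apex y.

module Submission where

open import Data.Bool using (Bool; true; false; not; _xor_)
open import Data.Bool.Properties using (not-involutive)
open import Data.Fin using (Fin; zero; suc; toℕ; fromℕ; inject₁)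
open import Data.Fin.Properties using (+↔⊎; all?; suc-injective; toℕ-fromℕ; toℕ-inject₁; toℕ-injective)
open import Data.Fin.Subset using (Subset; inside; outside; _∈_; _∪_; ⁅_⁆; ∣_∣)
open import Data.Fin.Subset.Properties using (_∈?_; anySubset?; ∣p∣≤n; ∣⁅x⁆∣≡1; x∈⁅y⁆⇒x≡y; x∈p∪q⁻)
open import Data.Maybe using (Maybe; just; nothing)
open import Data.Nat using (ℕ; _+_; _*_; _∸_; _^_; _≤_; _≥_)
open import Data.Nat using (zero; suc; z≤n; s≤s)
open import Data.Nat.Divisibility using (divides; m∣m*n; ∣m+n∣m⇒∣n; ∣1⇒≡1)
open import Data.Nat.Solver using () renaming (module +-*-Solver to ℕ-Solver)
open import Data.Product using (Σ-syntax; ∃-syntax; _×_)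
open import Data.Product using (_,_; proj₁; proj₂)
open import Data.Rational using (ℚ; 0ℚ; 1ℚ; ½; positive; nonNegative)
  renaming (_+_ to _+ʳ_; _*_ to _*ʳ_; _-_ to _-ʳ_; _≤_ to _≤ʳ_; _<_ to _<ʳ_)
open import Data.Rational.Solver using () renaming (module +-*-Solver to ℚ-Solver)
open import Data.Sum using (_⊎_; inj₁; inj₂)
open import Data.Sum.Function.Propositional using (_⊎-↔_)
open import Data.Vec using (Vec; []; _∷_; map; replicate; here; there)
open import Data.Vec.Properties using (∷-injectiveʳ; map-replicate)
open import Defs
open import Function using (_∘_)
open import Function.Bundles using (_↔_; mk↔ₛ′; module Inverse)
open import Function.Definitions using (Injective)
open import Function.Properties.Inverse using (↔-refl; ↔-sym; ↔-trans; ↔⇒↣)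
open import Relation.Binary.Definitions using (tri<; tri≈; tri>)
open import Relation.Binary.PropositionalEquality
open import Relation.Nullary using (¬_; Dec; yes; no; contradiction)
open import Relation.Nullary.Decidable using (map′; from-yes; via-injection; ¬?; _×-dec_; _⊎-dec_; _→-dec_)
open import Relation.Unary using (Decidable)
import Algebra.Properties.Group as Group
import Data.Fin as Fin
import Data.Fin.Properties as Fin
import Data.Nat as ℕ
import Data.Nat.Properties as ℕ
import Data.Product as ×
import Data.Rational as ℚ
import Data.Rational.Properties as ℚ
import Data.Sum as ⊎

-- Cliques

∣p∪q∣≡∣p∣+∣q∣ : ∀ {n} (p q : Subset n) → (∀ {x} → x ∈ p → ¬ (x ∈ q)) → ∣ p ∪ q ∣ ≡ ∣ p ∣ + ∣ q ∣
∣p∪q∣≡∣p∣+∣q∣ []            []            _        = refl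
∣p∪q∣≡∣p∣+∣q∣ (inside ∷ p)  (inside ∷ q)  disjoint = contradiction here (disjoint here)
∣p∪q∣≡∣p∣+∣q∣ (inside ∷ p)  (outside ∷ q) disjoint =
  cong suc (∣p∪q∣≡∣p∣+∣q∣ p q λ x∈p x∈q → disjoint (there x∈p) (there x∈q))
∣p∪q∣≡∣p∣+∣q∣ (outside ∷ p) (inside ∷ q)  disjoint =
  trans (cong suc (∣p∪q∣≡∣p∣+∣q∣ p q λ x∈p x∈q → disjoint (there x∈p) (there x∈q))) (sym (ℕ.+-suc ∣ p ∣ ∣ q ∣))
∣p∪q∣≡∣p∣+∣q∣ (outside ∷ p) (outside ∷ q) disjoint =
  ∣p∪q∣≡∣p∣+∣q∣ p q λ x∈p x∈q → disjoint (there x∈p) (there x∈q)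

-- Induction on the first bit: the two half images are disjoint because `f` separates vectors with
-- different heads, so their sizes add.
image : ∀ {n m} (f : Vec Bool n → Fin m) → Injective _≡_ _≡_ f →
        Σ[ S ∈ Subset m ] ∣ S ∣ ≡ 2 ^ n × (∀ {x} → x ∈ S → ∃[ A ] x ≡ f A)
image {zero}  f _     = ⁅ f [] ⁆ , ∣⁅x⁆∣≡1 (f []) , λ x∈ → [] , x∈⁅y⁆⇒x≡y _ x∈
image {suc n} f f-inj
  with image (f ∘ (false ∷_)) (∷-injectiveʳ ∘ f-inj) | image (f ∘ (true ∷_)) (∷-injectiveʳ ∘ f-inj)
... | S , ∣S∣ , S⊆ | T , ∣T∣ , T⊆ = S ∪ T , card , members
  where
  disjoint : ∀ {x} → x ∈ S → ¬ (x ∈ T)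
  disjoint x∈S x∈T with S⊆ x∈S | T⊆ x∈T
  ... | A , refl | B , eq with f-inj eq
  ... | ()
  card : ∣ S ∪ T ∣ ≡ 2 ^ suc n
  card = trans (∣p∪q∣≡∣p∣+∣q∣ S T disjoint) (cong₂ _+_ ∣S∣ (trans ∣T∣ (sym (ℕ.+-identityʳ (2 ^ n)))))
  members : ∀ {x} → x ∈ S ∪ T → ∃[ A ] x ≡ f A
  members x∈ with x∈p∪q⁻ S T x∈
  ... | inj₁ x∈S = let A , eq = S⊆ x∈S in false ∷ A , eq
  ... | inj₂ x∈T = let A , eq = T⊆ x∈T in true ∷ A , eq

-- Downward search from the bound: where `P n` fails, all witnesses lie strictly below `n`.
maximum : {P : ℕ → Set} → (∀ w → Dec (P w)) → ∀ {n} → (∀ {w} → P w → w ≤ n) → ∀ {w} → P w →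
          ∃[ m ] P m × (∀ {v} → P v → v ≤ m) × w ≤ m
maximum P? {n} bound Pw with P? n
... | yes Pn = n , Pn , bound , bound Pw
maximum {P} P? {zero} bound Pw | no ¬Pn = contradiction (subst P (ℕ.≤-antisym (bound Pw) z≤n) Pw) ¬Pn
maximum {P} P? {suc n} bound Pw | no ¬Pn = maximum P? lower Pw
  where
  lower : ∀ {w} → P w → w ≤ n
  lower Pw with ℕ.m≤n⇒m<n∨m≡n (bound Pw)
  ... | inj₁ (s≤s w≤n) = w≤n
  ... | inj₂ refl      = contradiction Pw ¬Pn

isClique? : ∀ H S → Dec (IsClique H S)
isClique? H S = all? λ x → all? λ y → (x ∈? S) →-dec (y ∈? S) →-dec ¬? (x Fin.≟ y) →-dec Graph.adj? H x y

-- Clique sizes form a decidable set bounded by the order, so a largest one exists; any single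
-- clique bounds it from below.
cliqueNumber : ∀ H S → IsClique H S → ∃[ w ] IsCliqueNumber H w × w ≥ ∣ S ∣
cliqueNumber H S clique =
  let w , attained , maximal , ≥∣S∣ = maximum
        (λ w → anySubset? λ T → isClique? H T ×-dec (∣ T ∣ ℕ.≟ w))
        (λ { (T , _ , refl) → ∣p∣≤n T })
        (S , clique , refl)
  in w , (attained , λ T cliqueT → maximal (T , cliqueT , refl)) , ≥∣S∣

-- The network

-- In `Inner j d` and `Link j d` the network has j + 1 colours inside and an
-- outside path of length d + 1.  `diag` lists the path from y = left* sink
-- to z = right* source.
data Inner : ℕ → ℕ → Set where
  left right : ∀ {j d} → Inner j (suc d) → Inner (suc j) d
  diag       : ∀ {j d} → Fin (suc (suc d)) → Inner (suc j) d

data Node (j d : ℕ) : Set where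
  source sink : Node j d
  inner       : Inner j d → Node j d

left* right* : ∀ {j d} → Node j (suc d) → Node (suc j) d
left* source     = source
left* sink       = inner (diag zero)
left* (inner v)  = inner (left v)
right* source    = inner (diag (fromℕ _))
right* sink      = sink
right* (inner v) = inner (right v)

data Link : ℕ → ℕ → Set where
  base          : ∀ {d} → Link zero d
  left right    : ∀ {j d} → Link j (suc d) → Link (suc j) d
  spokeˡ spokeʳ : ∀ {j d} → Link (suc j) d
  diag          : ∀ {j d} → Fin (suc d) → Link (suc j) d

end₁ end₂ : ∀ {j d} → Link j d → Node j d
end₁ base      = source
end₁ (left e)  = left* (end₁ e)
end₁ (right e) = right* (end₁ e)
end₁ spokeˡ    = source
end₁ spokeʳ    = left* sink
end₁ (diag i)  = inner (diag (inject₁ i))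
end₂ base      = sink
end₂ (left e)  = left* (end₂ e)
end₂ (right e) = right* (end₂ e)
end₂ spokeˡ    = right* source
end₂ spokeʳ    = sink
end₂ (diag i)  = inner (diag (suc i))

-- The cases overlap: y is both `left* sink` and `diag zero`, and z is both `right* source` and the
-- last `diag` node.
data View {j d} : Node (suc j) d → Set where
  isLeft  : ∀ v → View (left* v)
  isRight : ∀ v → View (right* v)
  isDiag  : ∀ i → View (inner (diag i))

view : ∀ {j d} (v : Node (suc j) d) → View v
view source            = isLeft source
view sink              = isRight sink
view (inner (left v))  = isLeft (inner v)
view (inner (right v)) = isRight (inner v)
view (inner (diag i))  = isDiag i

left*-injective : ∀ {j d} {u v : Node j (suc d)} → left* u ≡ left* v → u ≡ v
left*-injective {j} {d} {u} {v} eq = trans (sym (unleft-left* u)) (trans (cong unleft eq) (unleft-left* v))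
  where
  unleft : Node (suc j) d → Node j (suc d)
  unleft source           = source
  unleft (inner (left v)) = inner v
  -- This catches y, the image of `sink`; off the image of `left*` the value is arbitrary.
  unleft _                = sink
  unleft-left* : ∀ v → unleft (left* v) ≡ v
  unleft-left* source    = refl
  unleft-left* sink      = refl
  unleft-left* (inner v) = refl

right*-injective : ∀ {j d} {u v : Node j (suc d)} → right* u ≡ right* v → u ≡ v
right*-injective {j} {d} {u} {v} eq = trans (sym (unright-right* u)) (trans (cong unright eq) (unright-right* v))
  where
  unright : Node (suc j) d → Node j (suc d)
  unright sink              = sink
  unright (inner (right v)) = inner v
  unright _                 = source
  unright-right* : ∀ v → unright (right* v) ≡ v
  unright-right* source    = refl
  unright-right* sink      = refl
  unright-right* (inner v) = refl

inject₁≢suc : ∀ {n} (i : Fin n) → inject₁ i ≢ suc i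
inject₁≢suc zero    ()
inject₁≢suc (suc i) eq = inject₁≢suc i (suc-injective eq)

inner-diag-injective : ∀ {j d} {i k : Fin (suc (suc d))} → inner {suc j} (diag i) ≡ inner (diag k) → i ≡ k
inner-diag-injective refl = refl

ends-distinct : ∀ {j d} (e : Link j d) → end₁ e ≢ end₂ e
ends-distinct base      ()
ends-distinct (left e)  = ends-distinct e ∘ left*-injective
ends-distinct (right e) = ends-distinct e ∘ right*-injective
ends-distinct spokeˡ    ()
ends-distinct spokeʳ    ()
ends-distinct (diag i)  = inject₁≢suc i ∘ inner-diag-injective

size : ℕ → ℕ → ℕ
size zero    d = 0
size (suc j) d = size j (suc d) + (size j (suc d) + suc (suc d))

Inner↔Fin : ∀ j d → Inner j d ↔ Fin (size j d)
Inner↔Fin zero    d = mk↔ₛ′ (λ ()) (λ ()) (λ ()) (λ ())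
Inner↔Fin (suc j) d = ↔-trans split (↔-trans (IH ⊎-↔ ↔-trans (IH ⊎-↔ ↔-refl) (↔-sym +↔⊎)) (↔-sym +↔⊎))
  where
  IH : Inner j (suc d) ↔ Fin (size j (suc d))
  IH = Inner↔Fin j (suc d)
  split : Inner (suc j) d ↔ (Inner j (suc d) ⊎ Inner j (suc d) ⊎ Fin (suc (suc d)))
  split = mk↔ₛ′
    (λ { (left v) → inj₁ v ; (right v) → inj₂ (inj₁ v) ; (diag i) → inj₂ (inj₂ i) })
    ⊎.[ left , ⊎.[ right , diag ] ]
    (λ { (inj₁ _) → refl ; (inj₂ (inj₁ _)) → refl ; (inj₂ (inj₂ _)) → refl })
    (λ { (left _) → refl ; (right _) → refl ; (diag _) → refl })

Fin↔Node : ∀ j d → Fin (suc (suc (size j d))) ↔ Node j d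
Fin↔Node j d = mk↔ₛ′
  (λ { zero → source ; (suc zero) → sink ; (suc (suc i)) → inner (from i) })
  (λ { source → zero ; sink → suc zero ; (inner v) → suc (suc (to v)) })
  (λ { source → refl ; sink → refl ; (inner v) → cong inner (strictlyInverseʳ v) })
  (λ { zero → refl ; (suc zero) → refl ; (suc (suc i)) → cong (λ i → suc (suc i)) (strictlyInverseˡ i) })
  where open Inverse (Inner↔Fin j d)

anyLink? : ∀ {j d} {P : Link j d → Set} → Decidable P → Dec (∃[ e ] P e)
anyLink? {zero}  P? = map′ (λ p → base , p) (λ { (base , p) → p }) (P? base)
anyLink? {suc j} P? = map′
  (λ { (inj₁ (e , p))                             → left e , p
     ; (inj₂ (inj₁ (e , p)))                      → right e , p
     ; (inj₂ (inj₂ (inj₁ p)))                     → spokeˡ , p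
     ; (inj₂ (inj₂ (inj₂ (inj₁ p))))              → spokeʳ , p
     ; (inj₂ (inj₂ (inj₂ (inj₂ (i , p)))))        → diag i , p })
  (λ { (left e , p)  → inj₁ (e , p)
     ; (right e , p) → inj₂ (inj₁ (e , p))
     ; (spokeˡ , p)  → inj₂ (inj₂ (inj₁ p))
     ; (spokeʳ , p)  → inj₂ (inj₂ (inj₂ (inj₁ p)))
     ; (diag i , p)  → inj₂ (inj₂ (inj₂ (inj₂ (i , p)))) })
  (anyLink? (P? ∘ left) ⊎-dec anyLink? (P? ∘ right) ⊎-dec P? spokeˡ ⊎-dec P? spokeʳ ⊎-dec Fin.any? (P? ∘ diag))

-- `nothing` is the edge source-sink that closes the network.
Bond : ℕ → Set
Bond i = Maybe (Link (suc i) 0)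

bond₁ bond₂ : ∀ {i} → Bond i → Node (suc i) 0
bond₁ (just e) = end₁ e
bond₁ nothing  = source
bond₂ (just e) = end₂ e
bond₂ nothing  = sink

bond₁≢bond₂ : ∀ {i} (b : Bond i) → bond₁ b ≢ bond₂ b
bond₁≢bond₂ (just e) = ends-distinct e
bond₁≢bond₂ nothing  ()

anyBond? : ∀ {i} {P : Bond i → Set} → Decidable P → Dec (∃[ b ] P b)
anyBond? P? = map′
  (λ { (inj₁ p) → nothing , p ; (inj₂ (e , p)) → just e , p })
  (λ { (nothing , p) → inj₁ p ; (just e , p) → inj₂ (e , p) })
  (P? nothing ⊎-dec anyLink? (P? ∘ just))

Joins : ∀ {i} → Bond i → Node (suc i) 0 → Node (suc i) 0 → Set
Joins b u v = (u ≡ bond₁ b × v ≡ bond₂ b) ⊎ (u ≡ bond₂ b × v ≡ bond₁ b)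

-- The closed network as a graph.

module _ (i : ℕ) where

  open Inverse (Fin↔Node (suc i) 0) public using ()
    renaming (to to node; from to code; strictlyInverseˡ to node-code; strictlyInverseʳ to code-node)

  node-injective : ∀ {a b} → node a ≡ node b → a ≡ b
  node-injective {a} {b} eq = trans (sym (code-node a)) (trans (cong code eq) (code-node b))

  code-injective : Injective _≡_ _≡_ code
  code-injective {u} {v} eq = trans (sym (node-code u)) (trans (cong node eq) (node-code v))

  _≟ⁿ_ : (u v : Node (suc i) 0) → Dec (u ≡ v)
  _≟ⁿ_ = via-injection (↔⇒↣ (↔-sym (Fin↔Node (suc i) 0))) Fin._≟_

  G : Graph
  G = record
    { order  = suc (suc (size (suc i) 0))
    ; Adj    = λ a b → ∃[ e ] Joins {i} e (node a) (node b)
    ; symm   = λ { (e , j) → e , ⊎.swap (⊎.map ×.swap ×.swap j) }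
    ; irrefl = λ { refl (e , inj₁ (p , q)) → bond₁≢bond₂ e (trans (sym p) q)
                 ; refl (e , inj₂ (p , q)) → bond₁≢bond₂ e (trans (sym q) p) }
    ; adj?   = λ a b → anyBond? λ e →
                 ((node a ≟ⁿ bond₁ e) ×-dec (node b ≟ⁿ bond₂ e)) ⊎-dec
                 ((node a ≟ⁿ bond₂ e) ×-dec (node b ≟ⁿ bond₁ e))
    }

-- Odd girth

data Flip : ∀ {n} → Vec Bool n → Vec Bool n → Set where
  here  : ∀ {n b} {u : Vec Bool n} → Flip (b ∷ u) (not b ∷ u)
  there : ∀ {n b} {u v : Vec Bool n} → Flip u v → Flip (b ∷ u) (b ∷ v)

Flip-sym : ∀ {n} {u v : Vec Bool n} → Flip u v → Flip v u
Flip-sym (here {b = b} {u}) = subst (λ c → Flip (not b ∷ u) (c ∷ u)) (not-involutive b) here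
Flip-sym (there f)          = there (Flip-sym f)

complement : ∀ {n} → Vec Bool n → Vec Bool n
complement = map not

complement-involutive : ∀ {n} (u : Vec Bool n) → complement (complement u) ≡ u
complement-involutive []      = refl
complement-involutive (b ∷ u) = cong₂ _∷_ (not-involutive b) (complement-involutive u)

Flip-complement : ∀ {n} {u v : Vec Bool n} → Flip u v → Flip (complement u) (complement v)
Flip-complement here      = here
Flip-complement (there f) = there (Flip-complement f)

bit : Bool → ℕ
bit false = 0
bit true  = 1

distance : ∀ {n} → Vec Bool n → Vec Bool n → ℕ
distance []      []      = 0
distance (a ∷ u) (b ∷ v) = bit (a xor b) + distance u v

distance-refl : ∀ {n} (u : Vec Bool n) → distance u u ≡ 0
distance-refl []          = refl
distance-refl (false ∷ u) = distance-refl u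
distance-refl (true ∷ u)  = distance-refl u

distance-complement : ∀ {n} (u : Vec Bool n) → distance u (complement u) ≡ n
distance-complement []          = refl
distance-complement (false ∷ u) = cong suc (distance-complement u)
distance-complement (true ∷ u)  = cong suc (distance-complement u)

distance-flip : ∀ {n} (u : Vec Bool n) {v v′} → Flip v v′ →
                distance u v′ ≡ suc (distance u v) ⊎ distance u v ≡ suc (distance u v′)
distance-flip (false ∷ u) (here {b = false}) = inj₁ refl
distance-flip (false ∷ u) (here {b = true})  = inj₂ refl
distance-flip (true ∷ u)  (here {b = false}) = inj₂ refl
distance-flip (true ∷ u)  (here {b = true})  = inj₁ refl
distance-flip (a ∷ u) (there {b = b} f) =
  ⊎.map (λ eq → trans (cong (bit (a xor b) +_) eq) (ℕ.+-suc _ _))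
        (λ eq → trans (cong (bit (a xor b) +_) eq) (ℕ.+-suc _ _)) (distance-flip u f)

-- What `l` flips leading from `u` to `v` guarantee: `l` is at least the Hamming distance and has
-- its parity.
Excess : ∀ {n} → ℕ → Vec Bool n → Vec Bool n → Set
Excess l u v = ∃[ t ] l ≡ distance u v + 2 * t

Excess-flip : ∀ {n l} (u : Vec Bool n) {v v′} → Excess l u v → Flip v v′ → Excess (suc l) u v′
Excess-flip u {v} {v′} (t , refl) f with distance-flip u f
... | inj₁ eq = t , cong (_+ 2 * t) (sym eq)
... | inj₂ eq = suc t , (begin
  suc (distance u v + 2 * t)             ≡⟨ cong (λ k → suc (k + 2 * t)) eq ⟩
  suc (suc (distance u v′ + 2 * t))      ≡⟨ cong suc (ℕ.+-suc (distance u v′) (2 * t)) ⟨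
  suc (distance u v′ + suc (2 * t))      ≡⟨ ℕ.+-suc (distance u v′) (suc (2 * t)) ⟨
  distance u v′ + (2 + 2 * t)            ≡⟨ cong (distance u v′ +_) (ℕ.*-suc 2 t) ⟨
  distance u v′ + 2 * suc t              ∎)
  where open ≡-Reasoning

Step : ∀ {n} → Vec Bool n → Vec Bool n → Set
Step u v = Flip u v ⊎ v ≡ complement u

Step-sym : ∀ {n} {u v : Vec Bool n} → Step u v → Step v u
Step-sym (inj₁ f)    = inj₁ (Flip-sym f)
Step-sym {u = u} (inj₂ refl) = inj₂ (sym (complement-involutive u))

-- The two cases are walks with an even and an odd number of complementations.
Reach : ∀ {n} → ℕ → Vec Bool n → Vec Bool n → Set
Reach l u v = Excess l u v ⊎ (∃[ m ] l ≡ suc m × Excess m u (complement v))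

-- Flips commute with complementation and two complementations cancel, so only the parity of their
-- number is recorded; a cancelled pair adds 2 to the excess.
Reach-step : ∀ {n l} (u : Vec Bool n) {v v′} → Reach l u v → Step v v′ → Reach (suc l) u v′
Reach-step u (inj₁ r)              (inj₁ f)    = inj₁ (Excess-flip u r f)
Reach-step u (inj₂ (_ , refl , r)) (inj₁ f)    = inj₂ (_ , refl , Excess-flip u r (Flip-complement f))
Reach-step {l = l} u {v} (inj₁ r) (inj₂ refl) =
  inj₂ (_ , refl , subst (Excess l u) (sym (complement-involutive v)) r)
Reach-step u {v} (inj₂ (m , refl , t , m≡)) (inj₂ refl) = inj₁ (suc t , (begin
  suc (suc m)                                   ≡⟨ cong (λ k → suc (suc k)) m≡ ⟩
  suc (suc (distance u (complement v) + 2 * t)) ≡⟨ cong suc (ℕ.+-suc _ (2 * t)) ⟨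
  suc (distance u (complement v) + suc (2 * t)) ≡⟨ ℕ.+-suc _ (suc (2 * t)) ⟨
  distance u (complement v) + (2 + 2 * t)       ≡⟨ cong (distance u (complement v) +_) (ℕ.*-suc 2 t) ⟨
  distance u (complement v) + 2 * suc t         ∎))
  where open ≡-Reasoning

-- With evenly many complementations the length is even. Otherwise the flips alone lead from `u` to
-- its complement, at distance `n`, and one complementation comes on top.
odd-closed : ∀ {n l} (u : Vec Bool n) → Reach l u u → Odd l → suc n ≤ l
odd-closed u (inj₁ (t , refl)) odd =
  contradiction (divides t (trans (cong (_+ 2 * t) (distance-refl u)) (ℕ.*-comm 2 t))) odd
odd-closed {n} u (inj₂ (_ , refl , t , refl)) _ =
  s≤s (subst (λ k → n ≤ k + 2 * t) (sym (distance-complement u)) (ℕ.m≤m+n n (2 * t)))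

-- The inside colours, then the outside ones but one, whose edges complement;
-- `shift` moves the first outside colour of a half inside.
Label : ℕ → ℕ → Set
Label j d = Vec Bool (suc j) × Vec Bool d

data LabelStep {j d} : Label j d → Label j d → Set where
  flip₁ : ∀ {A A′ B} → Flip A A′ → LabelStep (A , B) (A′ , B)
  flip₂ : ∀ {A B B′} → Flip B B′ → LabelStep (A , B) (A , B′)
  compl : ∀ {A B} → LabelStep (A , B) (complement A , complement B)

shift : ∀ {j d} → Label j (suc d) → Label (suc j) d
shift (A , b ∷ B) = b ∷ A , B

shift-step : ∀ {j d} {p q : Label j (suc d)} → LabelStep p q → LabelStep (shift p) (shift q)
shift-step {p = _ , _ ∷ _}          (flip₁ f)         = flip₁ (there f)
shift-step {p = _ , _ ∷ _}          (flip₂ here)      = flip₁ here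
shift-step {p = _ , _ ∷ _}          (flip₂ (there f)) = flip₂ f
shift-step {p = _ , _ ∷ _}          compl             = compl

-- The right half starts at z instead of `source`, one flip of the newly gained inside colour away.
toggle : ∀ {j d} → Label j d → Label j d
toggle (a ∷ A , B) = not a ∷ A , B

toggle-step : ∀ {j d} {p q : Label j d} → LabelStep p q → LabelStep (toggle p) (toggle q)
toggle-step {p = _ ∷ _ , _} (flip₁ here)      = flip₁ here
toggle-step {p = _ ∷ _ , _} (flip₁ (there f)) = flip₁ (there f)
toggle-step {p = _ ∷ _ , _} (flip₂ f)         = flip₂ f
toggle-step {p = _ ∷ _ , _} compl             = compl

ones zeros : ∀ {n} → Vec Bool n
ones  = replicate _ true
zeros = replicate _ false

-- The first edge of the y-z path complements y = `(false ∷ ones , zeros)` to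
-- `(true ∷ zeros , ones)`; the other `d` edges clear the outside bits one at a time, ending at the
-- label of z.
staircase : ∀ {d} → Fin (suc d) → Vec Bool d
staircase zero              = ones
staircase {suc d} (suc i)   = false ∷ staircase i

staircase-last : ∀ d → staircase (fromℕ d) ≡ zeros
staircase-last zero    = refl
staircase-last (suc d) = cong (false ∷_) (staircase-last d)

staircase-flip : ∀ {d} (i : Fin d) → Flip (staircase (inject₁ i)) (staircase (suc i))
staircase-flip {suc d} zero    = here
staircase-flip {suc d} (suc i) = there (staircase-flip i)

labelᴵ : ∀ {j d} → Inner j d → Label j d
labelᴵ (left v)       = shift (labelᴵ v)
labelᴵ (right v)      = toggle (shift (labelᴵ v))
labelᴵ (diag zero)    = false ∷ ones , zeros
labelᴵ (diag (suc i)) = true ∷ zeros , staircase i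

label : ∀ {j d} → Node j d → Label j d
label source    = zeros , zeros
label sink      = ones , zeros
label (inner v) = labelᴵ v

label-left* : ∀ {j d} (v : Node j (suc d)) → label (left* v) ≡ shift (label v)
label-left* source    = refl
label-left* sink      = refl
label-left* (inner v) = refl

label-right* : ∀ {j d} (v : Node j (suc d)) → label (right* v) ≡ toggle (shift (label v))
label-right* source    = cong (true ∷ zeros ,_) (staircase-last _)
label-right* sink      = refl
label-right* (inner v) = refl

-- The map to the projective cube. Links inside a half inherit their step; both spokes flip the
-- first bit, the new inside colour.
label-step : ∀ {j d} (e : Link j d) → LabelStep (label (end₁ e)) (label (end₂ e))
label-step base      = flip₁ here
label-step (left e)  =
  subst₂ LabelStep (sym (label-left* (end₁ e))) (sym (label-left* (end₂ e))) (shift-step (label-step e))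
label-step (right e) =
  subst₂ LabelStep (sym (label-right* (end₁ e))) (sym (label-right* (end₂ e)))
    (toggle-step (shift-step (label-step e)))
label-step spokeˡ    = subst (LabelStep _) (sym (label-right* source)) (flip₁ here)
label-step spokeʳ    = flip₁ here
label-step (diag zero) = subst (LabelStep _)
  (cong₂ _,_ (cong (true ∷_) (map-replicate not true _)) (map-replicate not false _)) compl
label-step (diag (suc i)) = flip₂ (staircase-flip i)

module _ (i : ℕ) where

  cube : Node (suc i) 0 → Vec Bool (suc (suc i))
  cube v = proj₁ (label v)

  bond-step : ∀ b → Step (cube (bond₁ b)) (cube (bond₂ b))
  bond-step nothing  = inj₂ (sym (map-replicate not false (suc (suc i))))
  bond-step (just e) with label (end₁ e) | label (end₂ e) | label-step e
  -- For `d = 0` the second component is empty, so `flip₂` cannot occur.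
  ... | _ | _ | flip₁ f = inj₁ f
  ... | _ | _ | compl   = inj₂ refl

  adj-step : ∀ {a b} → Graph.Adj (G i) a b → Step (cube (node i a)) (cube (node i b))
  adj-step (e , inj₁ (p , q)) = subst₂ Step (cong cube (sym p)) (cong cube (sym q)) (bond-step e)
  adj-step (e , inj₂ (p , q)) = subst₂ Step (cong cube (sym p)) (cong cube (sym q)) (Step-sym (bond-step e))

  -- Read from the far end: a walk grows at its start, while `Reach-step` extends the second
  -- argument.
  walk-reach : ∀ {l a b} → Walk (G i) l a b → Reach l (cube (node i b)) (cube (node i a))
  walk-reach {b = b} []      = inj₁ (0 , sym (trans (ℕ.+-identityʳ _) (distance-refl (cube (node i b)))))
  walk-reach {b = b} (e ∷ w) = Reach-step (cube (node i b)) (walk-reach w) (Step-sym (adj-step e))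

path⇒walk : ∀ (H : Graph) {m} (v : Fin (suc m) → Graph.Vertex H) →
            (∀ k → Graph.Adj H (v (inject₁ k)) (v (suc k))) → Walk H m (v zero) (v (fromℕ m))
path⇒walk H {zero}  v adj = []
path⇒walk H {suc m} v adj = adj zero ∷ path⇒walk H (v ∘ suc) (adj ∘ suc)

odd-cycle-length : ∀ i l → Odd l → Cycle (G i) l → 3 + i ≤ l
odd-cycle-length i _ odd (cycle v _ _ adj close) =
  odd-closed (cube i (node i (v zero))) (walk-reach i (snoc (G i) (path⇒walk (G i) v adj) close)) odd

-- Walks between terminals

-- A source-sink path using each inside colour once: the nested left spokes, then the innermost
-- `base`. The closing edge completes it to the shortest odd cycle.
ladder : ∀ {j d} → Fin (suc (suc j)) → Node j d
ladder zero                 = source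
ladder {zero}  (suc zero)   = sink
ladder {suc j} (suc i)      = right* (ladder i)

source≢right* : ∀ {j d} (v : Node j (suc d)) → source ≢ right* v
source≢right* source    ()
source≢right* sink      ()
source≢right* (inner v) ()

ladder-injective : ∀ {j d} → Injective _≡_ _≡_ (ladder {j} {d})
ladder-injective         {x = zero}     {zero}     _  = refl
ladder-injective {zero}  {x = zero}     {suc zero} ()
ladder-injective {zero}  {x = suc zero} {zero}     ()
ladder-injective {zero}  {x = suc zero} {suc zero} _  = refl
ladder-injective {suc j} {x = zero}     {suc i}    eq = contradiction eq (source≢right* (ladder i))
ladder-injective {suc j} {x = suc i}    {zero}     eq = contradiction (sym eq) (source≢right* (ladder i))
ladder-injective {suc j} {x = suc i}    {suc k}    eq = cong suc (ladder-injective (right*-injective eq))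

ladder-last : ∀ {j d} → ladder {j} {d} (fromℕ (suc j)) ≡ sink
ladder-last {zero}  = refl
ladder-last {suc j} = cong right* ladder-last

ladder-link : ∀ {j d} (i : Fin (suc j)) → ∃[ e ] end₁ {j} {d} e ≡ ladder (inject₁ i) × end₂ e ≡ ladder (suc i)
ladder-link {zero}  zero    = base , refl , refl
ladder-link {suc j} zero    = spokeˡ , refl , refl
ladder-link {suc j} (suc i) = let e , p , q = ladder-link i in right e , cong right* p , cong right* q

module _ (i : ℕ) where

  link-adj : ∀ e → Graph.Adj (G i) (code i (end₁ e)) (code i (end₂ e))
  link-adj e = just e , inj₁ (node-code i (end₁ e) , node-code i (end₂ e))

  closing-adj : Graph.Adj (G i) (code i source) (code i sink)
  closing-adj = nothing , inj₁ (node-code i source , node-code i sink)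

  ladder-cycle : Cycle (G i) (3 + i)
  ladder-cycle = cycle (code i ∘ ladder) (s≤s (s≤s z≤n)) (ladder-injective ∘ code-injective i) rung
    (Graph.symm (G i) (subst (λ v → Graph.Adj (G i) (code i source) (code i v)) (sym ladder-last) closing-adj))
    where
    rung : ∀ k → Graph.Adj (G i) (code i (ladder (inject₁ k))) (code i (ladder (suc k)))
    rung k = let e , p , q = ladder-link k in
      subst₂ (λ u v → Graph.Adj (G i) (code i u) (code i v)) p q (link-adj e)

terminal : ∀ {j d} → Vec Bool (suc j) → Node j d
terminal {zero}  (false ∷ []) = source
terminal {zero}  (true ∷ [])  = sink
terminal {suc j} (false ∷ A)  = left* (terminal A)
terminal {suc j} (true ∷ A)   = right* (terminal A)

-- The labels that bound the odd girth also tell the terminals apart.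
label-terminal : ∀ {j d} (A : Vec Bool (suc j)) → label (terminal {j} {d} A) ≡ (A , zeros)
label-terminal {zero}  (false ∷ []) = refl
label-terminal {zero}  (true ∷ [])  = refl
label-terminal {suc j} (false ∷ A)  = trans (label-left* (terminal A)) (cong shift (label-terminal A))
label-terminal {suc j} (true ∷ A)   =
  trans (label-right* (terminal A)) (cong (λ p → toggle (shift p)) (label-terminal A))

terminal-injective : ∀ {j d} → Injective _≡_ _≡_ (terminal {j} {d})
terminal-injective {x = A} {B} eq =
  cong proj₁ (trans (sym (label-terminal A)) (trans (cong label eq) (label-terminal B)))

trues falses : ∀ {n} → Vec Bool n → ℕ
trues []           = 0
trues (true ∷ A)   = suc (trues A)
trues (false ∷ A)  = trues A
falses []          = 0
falses (true ∷ A)  = falses A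
falses (false ∷ A) = suc (falses A)

trues+falses : ∀ {n} (A : Vec Bool n) → trues A + falses A ≡ n
trues+falses []          = refl
trues+falses (true ∷ A)  = cong suc (trues+falses A)
trues+falses (false ∷ A) = trans (ℕ.+-suc (trues A) (falses A)) (cong suc (trues+falses A))

data Parity : ℕ → Set where
  even : ∀ t → Parity (2 * t)
  odd  : ∀ t → Parity (1 + 2 * t)

parity : ∀ n → Parity n
parity zero    = even 0
parity (suc n) with parity n
... | even t = odd t
... | odd t  = subst Parity (ℕ.*-suc 2 t) (even (suc t))

module _ (H : Graph) where
  open Graph H using (symm)

  _++ʷ_ : ∀ {l m x y z} → Walk H l x y → Walk H m y z → Walk H (l + m) x z
  []      ++ʷ w = w
  (e ∷ v) ++ʷ w = e ∷ (v ++ʷ w)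

  -- Goes back and forth along the first edge, hence the positive length.
  pad : ∀ {l x y} → Walk H (suc l) x y → ∀ t → Walk H (suc l + 2 * t) x y
  pad {l} {x} {y} w         zero    = subst (λ m → Walk H m x y) (sym (ℕ.+-identityʳ (suc l))) w
  pad {l} {x} {y} w@(e ∷ _) (suc t) = subst (λ m → Walk H m x y) eq (e ∷ symm e ∷ pad w t)
    where
    open ℕ-Solver
    eq : 2 + (suc l + 2 * t) ≡ suc l + 2 * suc t
    eq = solve 2 (λ l t → con 2 :+ (con 1 :+ l :+ con 2 :* t) := con 1 :+ l :+ con 2 :* (con 1 :+ t)) refl l t

  -- A copy of the network in the fixed graph `H`. The outside path of a half runs through the rest
  -- of `H`, so it is carried along the recursion as `outer`.
  record Embedding (j d : ℕ) : Set where
    field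
      φ     : Node j d → Graph.Vertex H
      adj   : ∀ e → Graph.Adj H (φ (end₁ e)) (φ (end₂ e))
      outer : Walk H (suc d) (φ source) (φ sink)

  open Embedding

  leftᴱ rightᴱ : ∀ {j d} → Embedding (suc j) d → Embedding j (suc d)
  leftᴱ E = record
    { φ = φ E ∘ left* ; adj = adj E ∘ left ; outer = snoc H (outer E) (symm (adj E spokeʳ)) }
  rightᴱ E = record
    { φ = φ E ∘ right* ; adj = adj E ∘ right ; outer = symm (adj E spokeˡ) ∷ outer E }

  -- The left half shares `source` with the network, while the source of the right half is one spoke
  -- away: one step for each one in `A`.
  from-source : ∀ {j d} (E : Embedding j d) A → Walk H (trues A) (φ E source) (φ E (terminal A))
  from-source {zero}  E (false ∷ []) = []
  from-source {zero}  E (true ∷ [])  = adj E base ∷ []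
  from-source {suc j} E (false ∷ A)  = from-source (leftᴱ E) A
  from-source {suc j} E (true ∷ A)   = adj E spokeˡ ∷ from-source (rightᴱ E) A

  to-sink : ∀ {j d} (E : Embedding j d) A → Walk H (falses A) (φ E (terminal A)) (φ E sink)
  to-sink {zero}  E (false ∷ []) = adj E base ∷ []
  to-sink {zero}  E (true ∷ [])  = []
  to-sink {suc j} E (false ∷ A)  = snoc H (to-sink (leftᴱ E) A) (adj E spokeʳ)
  to-sink {suc j} E (true ∷ A)   = to-sink (rightᴱ E) A

  diagonal : ∀ {j d} (E : Embedding (suc j) d) → Walk H (suc d) (φ E (left* sink)) (φ E (right* source))
  diagonal E = path⇒walk H (φ E ∘ inner ∘ diag) (adj E ∘ diag)

  -- A walk of the right parity that is not too long; `pad` brings it to length `N` unless it is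
  -- empty.
  Short : ℕ → Graph.Vertex H → Graph.Vertex H → Set
  Short N x y = ∃[ l ] ∃[ t ] Walk H l x y × l + 2 * t ≡ N

  Short-sym : ∀ {N x y} → Short N x y → Short N y x
  Short-sym (l , t , w , eq) = l , t , reverse H w , eq

  module _ {j d} (E : Embedding (suc j) d) (q : ℕ) (N-odd : suc j + d ≡ 1 + 2 * q) (A B : Vec Bool (suc j)) where
    private
      a b a′ b′ : ℕ
      a = trues A
      b = trues B
      a′ = falses A
      b′ = falses B
      x y : Graph.Vertex H
      x = φ E (left* (terminal A))
      y = φ E (right* (terminal B))

      via-source : Walk H (a + suc b) x y
      via-source = reverse H (from-source (leftᴱ E) A) ++ʷ (adj E spokeˡ ∷ from-source (rightᴱ E) B)

      via-sink : Walk H (a′ + suc b′) x y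
      via-sink = to-sink (leftᴱ E) A ++ʷ (adj E spokeʳ ∷ reverse H (to-sink (rightᴱ E) B))

      via-outer : Walk H (a + (suc d + b′)) x y
      via-outer = reverse H (from-source (leftᴱ E) A) ++ʷ (outer E ++ʷ reverse H (to-sink (rightᴱ E) B))

      via-diagonal : Walk H (a′ + (suc d + b)) x y
      via-diagonal = to-sink (leftᴱ E) A ++ʷ (diagonal E ++ʷ from-source (rightᴱ E) B)

      sizeᴬ : a + a′ + d ≡ 1 + 2 * q
      sizeᴬ = trans (cong (_+ d) (trues+falses A)) N-odd

      sizeᴮ : b + b′ + d ≡ 1 + 2 * q
      sizeᴮ = trans (cong (_+ d) (trues+falses B)) N-odd

      open ℕ-Solver

      -- The walks via source and via sink both have odd length here, and their lengths sum to
      -- `4 * q + 4 - 2 * d`, so at least one is at most `1 + 2 * q`.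
      balanced : ∀ p → a + b ≡ 2 * p → Short (1 + 2 * q) x y
      balanced p eq with ℕ.≤-<-connex p q
      ... | inj₁ p≤q with ℕ.m≤n⇒∃[o]m+o≡n p≤q
      ... | s , refl = a + suc b , s , via-source , (begin
        a + suc b + 2 * s
          ≡⟨ solve 3 (λ a b s →
               a :+ (con 1 :+ b) :+ con 2 :* s
               := con 1 :+ (a :+ b) :+ con 2 :* s)
               refl a b s ⟩
        1 + (a + b) + 2 * s  ≡⟨ cong (λ k → 1 + k + 2 * s) eq ⟩
        1 + 2 * p + 2 * s
          ≡⟨ solve 2 (λ p s →
               con 1 :+ con 2 :* p :+ con 2 :* s
               := con 1 :+ con 2 :* (p :+ s))
               refl p s ⟩
        1 + 2 * (p + s)      ∎)
        where open ≡-Reasoning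
      -- With `p = 1 + q + s` the walk via sink has length `1 + 2 * q - 2 * (s + d)`; adding `2 * p`
      -- to both sides avoids the subtraction.
      balanced p eq | inj₂ q<p with ℕ.m≤n⇒∃[o]m+o≡n q<p
      ... | s , refl = a′ + suc b′ , s + d , via-sink , ℕ.+-cancelˡ-≡ (2 * p) _ _ (begin
        2 * p + (a′ + suc b′ + 2 * (s + d))      ≡⟨ cong (_+ (a′ + suc b′ + 2 * (s + d))) eq ⟨
        a + b + (a′ + suc b′ + 2 * (s + d))
          ≡⟨ solve 6 (λ a b a′ b′ s d →
               a :+ b :+ (a′ :+ (con 1 :+ b′) :+ con 2 :* (s :+ d))
               := (a :+ a′ :+ d) :+ (b :+ b′ :+ d) :+ (con 1 :+ con 2 :* s))
               refl a b a′ b′ s d ⟩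
        (a + a′ + d) + (b + b′ + d) + (1 + 2 * s)  ≡⟨ cong₂ (λ m n → m + n + (1 + 2 * s)) sizeᴬ sizeᴮ ⟩
        (1 + 2 * q) + (1 + 2 * q) + (1 + 2 * s)
          ≡⟨ solve 2 (λ q s →
               (con 1 :+ con 2 :* q) :+ (con 1 :+ con 2 :* q) :+ (con 1 :+ con 2 :* s)
               := con 2 :* (con 1 :+ q :+ s) :+ (con 1 :+ con 2 :* q))
               refl q s ⟩
        2 * p + (1 + 2 * q)                        ∎)
        where open ≡-Reasoning

    -- If `a` and `b` have equal parity, `balanced` applies. If they differ by an odd number, the
    -- outside walk is short enough for `a < b`, and the walk along the y-z path for `b < a`.
    across : Short (1 + 2 * q) x y
    across with ℕ.<-cmp a b
    ... | tri≈ _ a≡b _ = balanced a (trans (cong (a +_) (sym a≡b)) (cong (a +_) (sym (ℕ.+-identityʳ a))))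
    ... | tri< a<b _ _ = less (ℕ.m≤n⇒∃[o]m+o≡n a<b)
      where
      less : ∃[ k ] suc a + k ≡ b → Short (1 + 2 * q) x y
      less (k , a+k≡b) with parity k
      -- Here `k` is `b - a - 1`, so `a + b` is even exactly when `k` is odd.
      ... | odd t  = balanced (1 + a + t) (trans (cong (a +_) (sym a+k≡b))
        (solve 2 (λ a t → a :+ (con 1 :+ a :+ (con 1 :+ con 2 :* t)) := con 2 :* (con 1 :+ a :+ t)) refl a t))
      -- As `a + 1 = b - 2 * t`, the outside walk has length `b + b′ + d - 2 * t`.
      ... | even t = a + (suc d + b′) , t , via-outer , (begin
        a + (suc d + b′) + 2 * t
          ≡⟨ solve 4 (λ a b′ d t →
               a :+ (con 1 :+ d :+ b′) :+ con 2 :* t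
               := con 1 :+ a :+ con 2 :* t :+ b′ :+ d)
               refl a b′ d t ⟩
        suc a + 2 * t + b′ + d      ≡⟨ cong (λ k → k + b′ + d) a+k≡b ⟩
        b + b′ + d                  ≡⟨ sizeᴮ ⟩
        1 + 2 * q                   ∎)
        where open ≡-Reasoning
    ... | tri> _ _ b<a = greater (ℕ.m≤n⇒∃[o]m+o≡n b<a)
      where
      greater : ∃[ k ] suc b + k ≡ a → Short (1 + 2 * q) x y
      greater (k , b+k≡a) with parity k
      ... | odd t  = balanced (1 + b + t) (trans (cong (_+ b) (sym b+k≡a))
        (solve 2 (λ b t → (con 1 :+ b :+ (con 1 :+ con 2 :* t)) :+ b := con 2 :* (con 1 :+ b :+ t)) refl b t))
      ... | even t = a′ + (suc d + b) , t , via-diagonal , (begin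
        a′ + (suc d + b) + 2 * t
          ≡⟨ solve 4 (λ b a′ d t →
               a′ :+ (con 1 :+ d :+ b) :+ con 2 :* t
               := con 1 :+ b :+ con 2 :* t :+ a′ :+ d)
               refl b a′ d t ⟩
        suc b + 2 * t + a′ + d      ≡⟨ cong (λ k → k + a′ + d) b+k≡a ⟩
        a + a′ + d                  ≡⟨ sizeᴬ ⟩
        1 + 2 * q                   ∎)
        where open ≡-Reasoning

  -- Labels with equal first bits lie in one half, where an inside colour has become an outside one;
  -- `j + d` and so the target length are unchanged.
  terminals-short : ∀ {j d} (E : Embedding j d) q → j + d ≡ 1 + 2 * q → ∀ A B → A ≢ B →
                    Short (1 + 2 * q) (φ E (terminal A)) (φ E (terminal B))
  terminals-short {zero} E q _ (false ∷ []) (false ∷ []) A≢B = contradiction refl A≢B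
  terminals-short {zero} E q _ (true ∷ [])  (true ∷ [])  A≢B = contradiction refl A≢B
  terminals-short {zero} E q _ (false ∷ []) (true ∷ [])  _   = 1 , q , adj E base ∷ [] , refl
  terminals-short {zero} E q _ (true ∷ [])  (false ∷ []) _   = 1 , q , symm (adj E base) ∷ [] , refl
  terminals-short {suc j} {d} E q eq (false ∷ A) (false ∷ B) A≢B =
    terminals-short (leftᴱ E) q (trans (ℕ.+-suc j d) eq) A B (A≢B ∘ cong (false ∷_))
  terminals-short {suc j} {d} E q eq (true ∷ A)  (true ∷ B)  A≢B =
    terminals-short (rightᴱ E) q (trans (ℕ.+-suc j d) eq) A B (A≢B ∘ cong (true ∷_))
  terminals-short {suc j} E q eq (false ∷ A) (true ∷ B)  _   = across E q eq A B
  terminals-short {suc j} E q eq (true ∷ A)  (false ∷ B) _   = Short-sym (across E q eq B A)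

  Short⇒Walk : ∀ {N x y} → x ≢ y → Short N x y → Walk H N x y
  -- An empty walk offers no edge to pad along, but it would identify the ends.
  Short⇒Walk x≢y (zero  , _ , []      , _)    = contradiction refl x≢y
  Short⇒Walk _   (suc l , t , w       , refl) = pad w t

-- Segments and separating functionals

open ℚ-Solver using (solve; _:+_; _:*_; _:-_; :-_; _:=_; con)

+-nonNeg : ∀ {p q} → 0ℚ ≤ʳ p → 0ℚ ≤ʳ q → 0ℚ ≤ʳ p +ʳ q
+-nonNeg = ℚ.+-mono-≤

*-nonNeg : ∀ {p q} → 0ℚ ≤ʳ p → 0ℚ ≤ʳ q → 0ℚ ≤ʳ p *ʳ q
*-nonNeg {p} {q} 0≤p 0≤q =
  ℚ.nonNegative⁻¹ (p *ʳ q) {{ℚ.nonNeg*nonNeg⇒nonNeg p {{nonNegative 0≤p}} q {{nonNegative 0≤q}}}}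

0<+ : ∀ {p q} → 0ℚ <ʳ p → 0ℚ ≤ʳ q → 0ℚ <ʳ p +ʳ q
0<+ = ℚ.+-mono-<-≤

0<* : ∀ {p q} → 0ℚ <ʳ p → 0ℚ <ʳ q → 0ℚ <ʳ p *ʳ q
0<* {p} {q} 0<p 0<q =
  ℚ.positive⁻¹ (p *ʳ q) {{ℚ.pos*pos⇒pos p {{positive 0<p}} q {{positive 0<q}}}}

0≤-⇒≤ : ∀ {p q} → 0ℚ ≤ʳ q -ʳ p → p ≤ʳ q
0≤-⇒≤ {p} {q} h = subst₂ _≤ʳ_ (ℚ.+-identityʳ p) (solve 2 (λ p q → p :+ (q :- p) := q) refl p q)
                            (ℚ.+-monoʳ-≤ p h)

0<-⇒< : ∀ {p q} → 0ℚ <ʳ q -ʳ p → p <ʳ q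
0<-⇒< {p} {q} h = subst₂ _<ʳ_ (ℚ.+-identityʳ p) (solve 2 (λ p q → p :+ (q :- p) := q) refl p q)
                            (ℚ.+-monoʳ-< p h)

≤⇒0≤- : ∀ {p q} → p ≤ʳ q → 0ℚ ≤ʳ q -ʳ p
≤⇒0≤- {p} {q} h = subst (_≤ʳ q -ʳ p) (ℚ.+-inverseʳ p) (ℚ.+-monoˡ-≤ (ℚ.- p) h)

<⇒0<- : ∀ {p q} → p <ʳ q → 0ℚ <ʳ q -ʳ p
<⇒0<- {p} {q} h = subst (_<ʳ q -ʳ p) (ℚ.+-inverseʳ p) (ℚ.+-monoˡ-< (ℚ.- p) h)

p-q≡0⇒p≡q : ∀ {p q} → p -ʳ q ≡ 0ℚ → p ≡ q
p-q≡0⇒p≡q {p} {q} eq = begin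
  p               ≡⟨ solve 2 (λ p q → p := (p :- q) :+ q) refl p q ⟩
  (p -ʳ q) +ʳ q   ≡⟨ cong (_+ʳ q) eq ⟩
  0ℚ +ʳ q         ≡⟨ ℚ.+-identityˡ q ⟩
  q               ∎ where open ≡-Reasoning

≤∧≢⇒< : ∀ {p q} → p ≤ʳ q → p ≢ q → p <ʳ q
≤∧≢⇒< {p} {q} p≤q p≢q with ℚ._<?_ p q
... | yes p<q = p<q
... | no  p≮q = contradiction (ℚ.≤-antisym p≤q (ℚ.≮⇒≥ p≮q)) p≢q

*-zero-split : ∀ {p q} → 0ℚ ≤ʳ p → 0ℚ ≤ʳ q → p *ʳ q ≤ʳ 0ℚ → p ≡ 0ℚ ⊎ q ≡ 0ℚ
*-zero-split {p} {q} 0≤p 0≤q pq≤0 with p ℚ.≟ 0ℚ | q ℚ.≟ 0ℚ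
... | yes p≡0 | _       = inj₁ p≡0
... | no  _   | yes q≡0 = inj₂ q≡0
... | no  p≢0 | no  q≢0 =
  contradiction (ℚ.<-≤-trans (0<* (≤∧≢⇒< 0≤p (≢-sym p≢0)) (≤∧≢⇒< 0≤q (≢-sym q≢0))) pq≤0) (ℚ.<-irrefl refl)

+-nonNeg-split : ∀ {p q} → 0ℚ ≤ʳ p → 0ℚ ≤ʳ q → p +ʳ q ≤ʳ 0ℚ → p ≤ʳ 0ℚ × q ≤ʳ 0ℚ
+-nonNeg-split {p} {q} 0≤p 0≤q h =
  ℚ.≤-trans (subst (_≤ʳ p +ʳ q) (ℚ.+-identityʳ p) (ℚ.+-monoʳ-≤ p 0≤q)) h ,
  ℚ.≤-trans (subst (_≤ʳ p +ʳ q) (ℚ.+-identityˡ q) (ℚ.+-monoˡ-≤ q 0≤p)) h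

Functional : Set
Functional = ℚ × ℚ × ℚ

⟦_⟧ : Functional → Point → ℚ
⟦ a , b , c ⟧ (x , y) = (a *ʳ x +ʳ b *ʳ y) +ʳ c

⟦⟧-along : ∀ f P Q t → ⟦ f ⟧ (along P Q t) ≡ (1ℚ -ʳ t) *ʳ ⟦ f ⟧ P +ʳ t *ʳ ⟦ f ⟧ Q
⟦⟧-along (a , b , c) (x , y) (x′ , y′) t =
  solve 8 (λ a b c x y x′ y′ t →
      a :* (x :+ t :* (x′ :- x)) :+ b :* (y :+ t :* (y′ :- y)) :+ c
      := (con 1ℚ :- t) :* (a :* x :+ b :* y :+ c) :+ t :* (a :* x′ :+ b :* y′ :+ c))
    refl a b c x y x′ y′ t

record _∈[_,_] (r P Q : Point) : Set where
  constructor _at_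
  field
    {parameter} : ℚ
    inUnit      : InUnit parameter
    along≡      : along P Q parameter ≡ r

along-0 : ∀ P Q → along P Q 0ℚ ≡ P
along-0 (x , y) (x′ , y′) = cong₂ _,_ (eq x x′) (eq y y′)
  where
  eq : ∀ u v → u +ʳ 0ℚ *ʳ (v -ʳ u) ≡ u
  eq = solve 2 (λ u v → u :+ con 0ℚ :* (v :- u) := u) refl

along-1 : ∀ P Q → along P Q 1ℚ ≡ Q
along-1 (x , y) (x′ , y′) = cong₂ _,_ (eq x x′) (eq y y′)
  where
  eq : ∀ u v → u +ʳ 1ℚ *ʳ (v -ʳ u) ≡ v
  eq = solve 2 (λ u v → u :+ con 1ℚ :* (v :- u) := v) refl

along-sym : ∀ P Q t → along P Q t ≡ along Q P (1ℚ -ʳ t)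
along-sym (x , y) (x′ , y′) t = cong₂ _,_ (eq x x′) (eq y y′)
  where
  eq : ∀ u v → u +ʳ t *ʳ (v -ʳ u) ≡ v +ʳ (1ℚ -ʳ t) *ʳ (u -ʳ v)
  eq u v = solve 3 (λ u v t → u :+ t :* (v :- u) := v :+ (con 1ℚ :- t) :* (u :- v)) refl u v t

segment-sym : ∀ {r P Q} → r ∈[ P , Q ] → r ∈[ Q , P ]
segment-sym {r} {P} {Q} (_at_ {t} (0≤t , t≤1) eq) =
  (≤⇒0≤- t≤1 , 0≤-⇒≤ (subst (0ℚ ≤ʳ_) (solve 1 (λ t → t := con 1ℚ :- (con 1ℚ :- t)) refl t) 0≤t)) at
  trans (sym (along-sym P Q t)) eq

-- The zero line of `f` can then meet the segment only in an end.
record NonNegOn (f : Functional) (P Q : Point) : Set where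
  constructor nonNegOn
  field
    0≤₁      : 0ℚ ≤ʳ ⟦ f ⟧ P
    0≤₂      : 0ℚ ≤ʳ ⟦ f ⟧ Q
    ¬both≡0 : ¬ (⟦ f ⟧ P ≡ 0ℚ × ⟦ f ⟧ Q ≡ 0ℚ)

⟦⟧-split : ∀ f {P Q t} → InUnit t → 0ℚ ≤ʳ ⟦ f ⟧ P → 0ℚ ≤ʳ ⟦ f ⟧ Q →
           0ℚ ≤ʳ (1ℚ -ʳ t) *ʳ ⟦ f ⟧ P × 0ℚ ≤ʳ t *ʳ ⟦ f ⟧ Q
⟦⟧-split f {P} {Q} {t} (0≤t , t≤1) 0≤P 0≤Q =
  *-nonNeg {1ℚ -ʳ t} {⟦ f ⟧ P} (≤⇒0≤- {t} {1ℚ} t≤1) 0≤P , *-nonNeg {t} {⟦ f ⟧ Q} 0≤t 0≤Q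

nonNeg-at : ∀ f {P Q r} → 0ℚ ≤ʳ ⟦ f ⟧ P → 0ℚ ≤ʳ ⟦ f ⟧ Q → r ∈[ P , Q ] → 0ℚ ≤ʳ ⟦ f ⟧ r
nonNeg-at f {P} {Q} 0≤P 0≤Q (_at_ {t} t∈ refl) =
  subst (0ℚ ≤ʳ_) (sym (⟦⟧-along f P Q t))
    (+-nonNeg {(1ℚ -ʳ t) *ʳ ⟦ f ⟧ P} {t *ʳ ⟦ f ⟧ Q} (proj₁ (⟦⟧-split f t∈ 0≤P 0≤Q)) (proj₂ (⟦⟧-split f t∈ 0≤P 0≤Q)))

-- The value at `r` is a convex combination of the end values. If it is not positive, both summands
-- vanish, and since `f` is not zero at both ends the parameter is 0 or 1.
touch : ∀ f {P Q r} → NonNegOn f P Q → r ∈[ P , Q ] → ⟦ f ⟧ r ≤ʳ 0ℚ → r ≡ P ⊎ r ≡ Q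
touch f {P} {Q} (nonNegOn 0≤P 0≤Q ¬0) (_at_ {t} t∈@(0≤t , t≤1) refl) r≤0 =
  cases (*-zero-split {1ℚ -ʳ t} {⟦ f ⟧ P} (≤⇒0≤- {t} {1ℚ} t≤1) 0≤P (proj₁ ≤0))
        (*-zero-split {t} {⟦ f ⟧ Q} 0≤t 0≤Q (proj₂ ≤0))
  where
  ≤0 : (1ℚ -ʳ t) *ʳ ⟦ f ⟧ P ≤ʳ 0ℚ × t *ʳ ⟦ f ⟧ Q ≤ʳ 0ℚ
  ≤0 = +-nonNeg-split {(1ℚ -ʳ t) *ʳ ⟦ f ⟧ P} {t *ʳ ⟦ f ⟧ Q}
         (proj₁ (⟦⟧-split f t∈ 0≤P 0≤Q)) (proj₂ (⟦⟧-split f t∈ 0≤P 0≤Q))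
         (subst (_≤ʳ 0ℚ) (⟦⟧-along f P Q t) r≤0)
  cases : 1ℚ -ʳ t ≡ 0ℚ ⊎ ⟦ f ⟧ P ≡ 0ℚ → t ≡ 0ℚ ⊎ ⟦ f ⟧ Q ≡ 0ℚ → along P Q t ≡ P ⊎ along P Q t ≡ Q
  cases (inj₁ 1-t≡0) _          = inj₂ (trans (cong (along P Q) (sym (p-q≡0⇒p≡q {1ℚ} {t} 1-t≡0))) (along-1 P Q))
  cases (inj₂ _)     (inj₁ t≡0) = inj₁ (trans (cong (along P Q) t≡0) (along-0 P Q))
  cases (inj₂ P≡0)   (inj₂ Q≡0) = contradiction (P≡0 , Q≡0) ¬0

*-cancelʳ : ∀ {p q r} → r ≢ 0ℚ → p *ʳ r ≡ q *ʳ r → p ≡ q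
*-cancelʳ {p} {q} {r} r≢0 eq = begin
  p                       ≡⟨ expand p ⟩
  (p *ʳ r) *ʳ ℚ.1/ r      ≡⟨ cong (_*ʳ ℚ.1/ r) eq ⟩
  (q *ʳ r) *ʳ ℚ.1/ r      ≡⟨ expand q ⟨
  q                       ∎
  where
  open ≡-Reasoning
  instance
    r-nonZero : ℚ.NonZero r
    r-nonZero = ℚ.≢-nonZero r≢0
  expand : ∀ p → p ≡ (p *ʳ r) *ʳ ℚ.1/ r
  expand p = sym (trans (ℚ.*-assoc p r (ℚ.1/ r)) (trans (cong (p *ʳ_) (ℚ.*-inverseʳ r)) (ℚ.*-identityʳ p)))

along-injective : ∀ {P Q} → P ≢ Q → ∀ {s t} → along P Q s ≡ along P Q t → s ≡ t
along-injective {x , y} {x′ , y′} P≢Q {s} {t} eq with x′ ℚ.≟ x | y′ ℚ.≟ y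
... | yes x′≡x | yes y′≡y = contradiction (cong₂ _,_ (sym x′≡x) (sym y′≡y)) P≢Q
... | no  x′≢x | _        = *-cancelʳ {s} {t} {x′ -ʳ x} (x′≢x ∘ p-q≡0⇒p≡q {x′} {x})
  (Group.∙-cancelˡ ℚ.+-0-group x (s *ʳ (x′ -ʳ x)) (t *ʳ (x′ -ʳ x)) (cong proj₁ eq))
... | yes _    | no y′≢y  = *-cancelʳ {s} {t} {y′ -ʳ y} (y′≢y ∘ p-q≡0⇒p≡q {y′} {y})
  (Group.∙-cancelˡ ℚ.+-0-group y (s *ʳ (y′ -ʳ y)) (t *ʳ (y′ -ʳ y)) (cong proj₂ eq))

segment : ∀ {P Q} → P ≢ Q → Arc P Q
segment {P} {Q} P≢Q = record
  { bends  = 0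
  ; corner = corner
  ; start  = refl
  ; end    = refl
  ; simple = λ { zero zero s t _ _ eq → cong (0ℚ +ʳ_) {s} {t} (along-injective {P} {Q} P≢Q {s} {t} eq) }
  }
  where
  corner : Fin 2 → Point
  corner zero    = P
  corner (suc _) = Q

neg : Functional → Functional
neg (a , b , c) = ℚ.- a , ℚ.- b , ℚ.- c

⟦neg⟧ : ∀ f P → ⟦ neg f ⟧ P ≡ ℚ.- ⟦ f ⟧ P
⟦neg⟧ (a , b , c) (x , y) =
  solve 5 (λ a b c x y → (:- a) :* x :+ (:- b) :* y :+ (:- c) := :- (a :* x :+ b :* y :+ c)) refl a b c x y

⟦neg⟧-nonPos : ∀ f {P} → 0ℚ ≤ʳ ⟦ neg f ⟧ P → ⟦ f ⟧ P ≤ʳ 0ℚ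
⟦neg⟧-nonPos f {P} h = 0≤-⇒≤ {⟦ f ⟧ P} {0ℚ}
  (subst (0ℚ ≤ʳ_) (trans (⟦neg⟧ f P) (sym (ℚ.+-identityˡ (ℚ.- ⟦ f ⟧ P)))) h)

⟦neg⟧≤0 : ∀ f P → 0ℚ ≤ʳ ⟦ f ⟧ P → ⟦ neg f ⟧ P ≤ʳ 0ℚ
⟦neg⟧≤0 f P h = subst (_≤ʳ 0ℚ) (sym (⟦neg⟧ f P)) (ℚ.neg-antimono-≤ h)

separate : ∀ f {P Q P′ Q′ r} → NonNegOn f P Q → 0ℚ ≤ʳ ⟦ neg f ⟧ P′ → 0ℚ ≤ʳ ⟦ neg f ⟧ Q′ →
           r ∈[ P , Q ] → r ∈[ P′ , Q′ ] → r ≡ P ⊎ r ≡ Q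
separate f {r = r} pq p′ q′ r∈ r∈′ = touch f pq r∈ (⟦neg⟧-nonPos f {r} (nonNeg-at (neg f) p′ q′ r∈′))

-- Drawing the network

-- The poles are at (1 , 0) and (0 , 1), the apex at (0 , 0); α, β, γ are the
-- barycentric coordinates of this triangle and δ vanishes on the line of y and z.
α β γ δ : Functional
α = 1ℚ , 0ℚ , 0ℚ
β = 0ℚ , 1ℚ , 0ℚ
γ = ℚ.- 1ℚ , ℚ.- 1ℚ , 1ℚ
δ = 1ℚ , ℚ.- 1ℚ , 0ℚ

-- The affine maps that send (source, sink, apex) to (source, y, z) and (z, sink, y),
-- where y = (h , h) and z = (l , l).
L R : ℚ → ℚ → Point → Point
L h l (a , b) = a +ʳ (b *ʳ h +ʳ (1ℚ -ʳ a -ʳ b) *ʳ l) , b *ʳ h +ʳ (1ℚ -ʳ a -ʳ b) *ʳ l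
R h l P = ×.swap (L l h (×.swap P))

-- Both sides are affine and agree at the corners: `δ` is 1 at source and 0 at y and z, as `α` is at
-- source, sink and apex.
δ-L : ∀ h l P → ⟦ δ ⟧ (L h l P) ≡ ⟦ α ⟧ P
δ-L h l (a , b) = solve 4 (λ a b h l →
  let s = b :* h :+ (con 1ℚ :- a :- b) :* l in
  con 1ℚ :* (a :+ s) :+ con (ℚ.- 1ℚ) :* s :+ con 0ℚ := con 1ℚ :* a :+ con 0ℚ :* b :+ con 0ℚ)
  refl a b h l

δ-R : ∀ h l P → ⟦ neg δ ⟧ (R h l P) ≡ ⟦ β ⟧ P
δ-R h l (a , b) = solve 4 (λ a b h l →
  let s = a :* l :+ (con 1ℚ :- b :- a) :* h in
  con (ℚ.- 1ℚ) :* s :+ con 1ℚ :* (b :+ s) :+ con 0ℚ := con 0ℚ :* a :+ con 1ℚ :* b :+ con 0ℚ)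
  refl a b h l

α-L : ∀ h l P → ⟦ α ⟧ (L h l P) ≡ ⟦ α ⟧ P +ʳ (⟦ β ⟧ P *ʳ h +ʳ ⟦ γ ⟧ P *ʳ l)
α-L h l (a , b) = solve 4 (λ a b h l →
  let s = b :* h :+ (con 1ℚ :- a :- b) :* l in
  con 1ℚ :* (a :+ s) :+ con 0ℚ :* s :+ con 0ℚ :=
  (con 1ℚ :* a :+ con 0ℚ :* b :+ con 0ℚ) :+
  ((con 0ℚ :* a :+ con 1ℚ :* b :+ con 0ℚ) :* h :+ (con (ℚ.- 1ℚ) :* a :+ con (ℚ.- 1ℚ) :* b :+ con 1ℚ) :* l))
  refl a b h l

β-L : ∀ h l P → ⟦ β ⟧ (L h l P) ≡ ⟦ β ⟧ P *ʳ h +ʳ ⟦ γ ⟧ P *ʳ l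
β-L h l (a , b) = solve 4 (λ a b h l →
  let s = b :* h :+ (con 1ℚ :- a :- b) :* l in
  con 0ℚ :* (a :+ s) :+ con 1ℚ :* s :+ con 0ℚ :=
  ((con 0ℚ :* a :+ con 1ℚ :* b :+ con 0ℚ) :* h :+ (con (ℚ.- 1ℚ) :* a :+ con (ℚ.- 1ℚ) :* b :+ con 1ℚ) :* l))
  refl a b h l

-- The coefficients are the values of `γ` at y and z; at source `γ` vanishes.
γ-L : ∀ h l P → ⟦ γ ⟧ (L h l P) ≡ ⟦ β ⟧ P *ʳ (1ℚ -ʳ (h +ʳ h)) +ʳ ⟦ γ ⟧ P *ʳ (1ℚ -ʳ (l +ʳ l))
γ-L h l (a , b) = solve 4 (λ a b h l →
  let s = b :* h :+ (con 1ℚ :- a :- b) :* l in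
  con (ℚ.- 1ℚ) :* (a :+ s) :+ con (ℚ.- 1ℚ) :* s :+ con 1ℚ :=
  (con 0ℚ :* a :+ con 1ℚ :* b :+ con 0ℚ) :* (con 1ℚ :- (h :+ h)) :+
  (con (ℚ.- 1ℚ) :* a :+ con (ℚ.- 1ℚ) :* b :+ con 1ℚ) :* (con 1ℚ :- (l :+ l)))
  refl a b h l

L-along : ∀ h l P Q t → L h l (along P Q t) ≡ along (L h l P) (L h l Q) t
L-along h l (a , b) (a′ , b′) t = cong₂ _,_
  (solve 7 (λ a b a′ b′ t h l →
    let s  = λ a b → b :* h :+ (con 1ℚ :- a :- b) :* l
        x  = a :+ t :* (a′ :- a)
        y  = b :+ t :* (b′ :- b) in
    x :+ s x y := (a :+ s a b) :+ t :* ((a′ :+ s a′ b′) :- (a :+ s a b))) refl a b a′ b′ t h l)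
  (solve 7 (λ a b a′ b′ t h l →
    let s  = λ a b → b :* h :+ (con 1ℚ :- a :- b) :* l
        x  = a :+ t :* (a′ :- a)
        y  = b :+ t :* (b′ :- b) in
    s x y := s a b :+ t :* (s a′ b′ :- s a b)) refl a b a′ b′ t h l)

R-along : ∀ h l P Q t → R h l (along P Q t) ≡ along (R h l P) (R h l Q) t
R-along h l P Q t = cong ×.swap (L-along l h (×.swap P) (×.swap Q) t)

-- The difference of the image coordinates is `a`; given `a`, the second coordinate determines `b`
-- because y and z are distinct.
L-injective : ∀ {h l P Q} → h ≢ l → L h l P ≡ L h l Q → P ≡ Q
L-injective {h} {l} {a , b} {a′ , b′} h≢l eq =
  cong₂ _,_ a≡a′ (*-cancelʳ {b} {b′} {h -ʳ l} (h≢l ∘ p-q≡0⇒p≡q {h} {l}) b≡b′)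
  where
  open ≡-Reasoning
  s : ℚ → ℚ → ℚ
  s a b = b *ʳ h +ʳ (1ℚ -ʳ a -ʳ b) *ʳ l
  a≡a′ : a ≡ a′
  a≡a′ = begin
    a                           ≡⟨ solve 2 (λ a s → a := (a :+ s) :- s) refl a (s a b) ⟩
    (a +ʳ s a b) -ʳ s a b       ≡⟨ cong₂ _-ʳ_ (cong proj₁ eq) (cong proj₂ eq) ⟩
    (a′ +ʳ s a′ b′) -ʳ s a′ b′  ≡⟨ solve 2 (λ a s → (a :+ s) :- s := a) refl a′ (s a′ b′) ⟩
    a′                          ∎
  isolate : ∀ a b → b *ʳ (h -ʳ l) ≡ s a b -ʳ (1ℚ -ʳ a) *ʳ l
  isolate a b = solve 4 (λ a b h l →
    b :* (h :- l) := (b :* h :+ (con 1ℚ :- a :- b) :* l) :- (con 1ℚ :- a) :* l) refl a b h l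
  b≡b′ : b *ʳ (h -ʳ l) ≡ b′ *ʳ (h -ʳ l)
  b≡b′ = begin
    b *ʳ (h -ʳ l)                ≡⟨ isolate a b ⟩
    s a b -ʳ (1ℚ -ʳ a) *ʳ l      ≡⟨ cong₂ (λ s a → s -ʳ (1ℚ -ʳ a) *ʳ l) (cong proj₂ eq) a≡a′ ⟩
    s a′ b′ -ʳ (1ℚ -ʳ a′) *ʳ l   ≡⟨ isolate a′ b′ ⟨
    b′ *ʳ (h -ʳ l)               ∎

R-injective : ∀ {h l P Q} → h ≢ l → R h l P ≡ R h l Q → P ≡ Q
R-injective h≢l eq = cong ×.swap (L-injective (≢-sym h≢l) (cong ×.swap eq))

Interior : Point → Set
Interior P = 0ℚ <ʳ ⟦ α ⟧ P × 0ℚ <ʳ ⟦ β ⟧ P × 0ℚ <ʳ ⟦ γ ⟧ P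

Interior-swap : ∀ P → Interior P → Interior (×.swap P)
Interior-swap (a , b) (0<α , 0<β , 0<γ) =
  subst (0ℚ <ʳ_) (solve 2 (λ a b → con 0ℚ :* a :+ con 1ℚ :* b :+ con 0ℚ
                               := con 1ℚ :* b :+ con 0ℚ :* a :+ con 0ℚ) refl a b) 0<β ,
  subst (0ℚ <ʳ_) (solve 2 (λ a b → con 1ℚ :* a :+ con 0ℚ :* b :+ con 0ℚ
                               := con 0ℚ :* b :+ con 1ℚ :* a :+ con 0ℚ) refl a b) 0<α ,
  subst (0ℚ <ʳ_) (solve 2 (λ a b → con (ℚ.- 1ℚ) :* a :+ con (ℚ.- 1ℚ) :* b :+ con 1ℚ
                               := con (ℚ.- 1ℚ) :* b :+ con (ℚ.- 1ℚ) :* a :+ con 1ℚ) refl a b) 0<γ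

L-interior : ∀ h l P → 0ℚ <ʳ h → 0ℚ <ʳ l → h +ʳ h <ʳ 1ℚ → l +ʳ l <ʳ 1ℚ → Interior P → Interior (L h l P)
L-interior h l P 0<h 0<l 2h<1 2l<1 (0<α , 0<β , 0<γ) =
  subst (0ℚ <ʳ_) (sym (α-L h l P)) (0<+ {⟦ α ⟧ P} {⟦ β ⟧ P *ʳ h +ʳ ⟦ γ ⟧ P *ʳ l} 0<α (ℚ.<⇒≤ s)) ,
  subst (0ℚ <ʳ_) (sym (β-L h l P)) s ,
  subst (0ℚ <ʳ_) (sym (γ-L h l P))
    (combo {1ℚ -ʳ (h +ʳ h)} {1ℚ -ʳ (l +ʳ l)} (<⇒0<- {h +ʳ h} {1ℚ} 2h<1) (<⇒0<- {l +ʳ l} {1ℚ} 2l<1))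
  where
  combo : ∀ {q s} → 0ℚ <ʳ q → 0ℚ <ʳ s → 0ℚ <ʳ ⟦ β ⟧ P *ʳ q +ʳ ⟦ γ ⟧ P *ʳ s
  combo {q} {s} 0<q 0<s =
    0<+ {⟦ β ⟧ P *ʳ q} {⟦ γ ⟧ P *ʳ s} (0<* {⟦ β ⟧ P} {q} 0<β 0<q) (ℚ.<⇒≤ (0<* {⟦ γ ⟧ P} {s} 0<γ 0<s))
  s : 0ℚ <ʳ ⟦ β ⟧ P *ʳ h +ʳ ⟦ γ ⟧ P *ʳ l
  s = combo {h} {l} 0<h 0<l

R-interior : ∀ h l P → 0ℚ <ʳ h → 0ℚ <ʳ l → h +ʳ h <ʳ 1ℚ → l +ʳ l <ʳ 1ℚ → Interior P → Interior (R h l P)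
R-interior h l P 0<h 0<l 2h<1 2l<1 =
  Interior-swap (L l h (×.swap P)) ∘ L-interior l h (×.swap P) 0<l 0<h 2l<1 2h<1 ∘ Interior-swap P

-- Positions on the line of y and z, y at index 0 and z at index `d + 1`. Starting at one quarter
-- and halving keeps them between 0 and one half, thus inside the triangle.
τ : ℕ → ℚ
τ zero    = ½ *ʳ ½
τ (suc i) = ½ *ʳ τ i

0<τ : ∀ i → 0ℚ <ʳ τ i
0<τ zero    = from-yes (0ℚ ℚ.<? τ 0)
0<τ (suc i) = 0<* {½} {τ i} (from-yes (0ℚ ℚ.<? ½)) (0<τ i)

τ-suc : ∀ i → τ (suc i) <ʳ τ i
τ-suc i = 0<-⇒< {τ (suc i)} {τ i} (subst (0ℚ <ʳ_) halve (0<τ (suc i)))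
  where
  halve : ½ *ʳ τ i ≡ τ i -ʳ ½ *ʳ τ i
  halve = solve 1 (λ t → con ½ :* t := t :- con ½ :* t) refl (τ i)

τ-antitone′ : ∀ {i k} → i ℕ.≤′ k → τ k ≤ʳ τ i
τ-antitone′ ℕ.≤′-refl            = ℚ.≤-refl
τ-antitone′ {i} (ℕ.≤′-step {k} i≤k) = ℚ.≤-trans {τ (suc k)} (ℚ.<⇒≤ (τ-suc k)) (τ-antitone′ i≤k)

τ-antitone : ∀ {i k} → i ℕ.≤ k → τ k ≤ʳ τ i
τ-antitone = τ-antitone′ ∘ ℕ.≤⇒≤′

τ-strict : ∀ {i k} → i ℕ.< k → τ k <ʳ τ i
τ-strict {i} i<k = ℚ.≤-<-trans (τ-antitone i<k) (τ-suc i)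

τ-injective : ∀ {i k} → τ i ≡ τ k → i ≡ k
τ-injective {i} {k} eq with ℕ.<-cmp i k
... | tri< i<k _ _ = contradiction (τ-strict i<k) (ℚ.<-irrefl (sym eq))
... | tri≈ _ i≡k _ = i≡k
... | tri> _ _ k<i = contradiction (τ-strict k<i) (ℚ.<-irrefl eq)

2τ<1 : ∀ i → τ i +ʳ τ i <ʳ 1ℚ
2τ<1 i = ℚ.≤-<-trans {τ i +ʳ τ i} {τ 0 +ʳ τ 0} (ℚ.+-mono-≤ {τ i} {τ 0} {τ i} {τ 0} τ≤ τ≤)
  (from-yes (τ 0 +ʳ τ 0 ℚ.<? 1ℚ))
  where
  τ≤ : τ i ≤ʳ τ 0
  τ≤ = τ-antitone {0} {i} z≤n

-- Positions of the nodes.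

Lᵈ Rᵈ : ℕ → Point → Point
Lᵈ d = L (τ 0) (τ (suc d))
Rᵈ d = R (τ 0) (τ (suc d))

τ₀≢τ₁₊ : ∀ d → τ 0 ≢ τ (suc d)
τ₀≢τ₁₊ d = ℕ.0≢1+n ∘ τ-injective {0} {suc d}

onDiagonal : ℕ → Point
onDiagonal i = τ i , τ i

posᴵ : ∀ {j d} → Inner j d → Point
posᴵ {d = d} (left v)  = Lᵈ d (posᴵ v)
posᴵ {d = d} (right v) = Rᵈ d (posᴵ v)
posᴵ         (diag i)  = onDiagonal (toℕ i)

pos : ∀ {j d} → Node j d → Point
pos source    = 1ℚ , 0ℚ
pos sink      = 0ℚ , 1ℚ
pos (inner v) = posᴵ v

L-source : ∀ h l → L h l (1ℚ , 0ℚ) ≡ (1ℚ , 0ℚ)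
L-source h l = cong₂ _,_
  (solve 2 (λ h l → con 1ℚ :+ (con 0ℚ :* h :+ (con 1ℚ :- con 1ℚ :- con 0ℚ) :* l) := con 1ℚ) refl h l)
  (solve 2 (λ h l → con 0ℚ :* h :+ (con 1ℚ :- con 1ℚ :- con 0ℚ) :* l := con 0ℚ) refl h l)

L-sink : ∀ h l → L h l (0ℚ , 1ℚ) ≡ (h , h)
L-sink h l = cong₂ _,_
  (solve 2 (λ h l → con 0ℚ :+ (con 1ℚ :* h :+ (con 1ℚ :- con 0ℚ :- con 1ℚ) :* l) := h) refl h l)
  (solve 2 (λ h l → con 1ℚ :* h :+ (con 1ℚ :- con 0ℚ :- con 1ℚ) :* l := h) refl h l)

L-apex : ∀ h l → L h l (0ℚ , 0ℚ) ≡ (l , l)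
L-apex h l = cong₂ _,_
  (solve 2 (λ h l → con 0ℚ :+ (con 0ℚ :* h :+ (con 1ℚ :- con 0ℚ :- con 0ℚ) :* l) := l) refl h l)
  (solve 2 (λ h l → con 0ℚ :* h :+ (con 1ℚ :- con 0ℚ :- con 0ℚ) :* l := l) refl h l)

pos-left* : ∀ {j d} (v : Node j (suc d)) → pos (left* v) ≡ Lᵈ d (pos v)
pos-left* {d = d} source    = sym (L-source (τ 0) (τ (suc d)))
pos-left* {d = d} sink      = sym (L-sink (τ 0) (τ (suc d)))
pos-left*         (inner v) = refl

pos-right*-source : ∀ {j d} → pos (right* {j} {d} source) ≡ onDiagonal (suc d)
pos-right*-source {d = d} = cong onDiagonal (toℕ-fromℕ (suc d))

pos-right* : ∀ {j d} (v : Node j (suc d)) → pos (right* v) ≡ Rᵈ d (pos v)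
pos-right* {j} {d} source = trans (pos-right*-source {j} {d}) (sym (cong ×.swap (L-sink (τ (suc d)) (τ 0))))
pos-right* {d = d} sink   = sym (cong ×.swap (L-source (τ (suc d)) (τ 0)))
pos-right* (inner v)      = refl

diagonal-interior : ∀ {p} → 0ℚ <ʳ p → p +ʳ p <ʳ 1ℚ → Interior (p , p)
diagonal-interior {p} 0<p 2p<1 =
  subst (0ℚ <ʳ_) (solve 1 (λ p → p := con 1ℚ :* p :+ con 0ℚ :* p :+ con 0ℚ) refl p) 0<p ,
  subst (0ℚ <ʳ_) (solve 1 (λ p → p := con 0ℚ :* p :+ con 1ℚ :* p :+ con 0ℚ) refl p) 0<p ,
  subst (0ℚ <ʳ_) (solve 1 (λ p → con 1ℚ :- (p :+ p) := con (ℚ.- 1ℚ) :* p :+ con (ℚ.- 1ℚ) :* p :+ con 1ℚ) refl p)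
    (<⇒0<- {p +ʳ p} {1ℚ} 2p<1)

-- Strictness leaves only the poles on the boundary: `α` vanishes only at `sink`, `β` only at
-- `source`, `γ` only at the two poles.
posᴵ-interior : ∀ {j d} (v : Inner j d) → Interior (posᴵ v)
posᴵ-interior {d = d} (left v)  =
  L-interior (τ 0) (τ (suc d)) (posᴵ v) (0<τ 0) (0<τ (suc d)) (2τ<1 0) (2τ<1 (suc d)) (posᴵ-interior v)
posᴵ-interior {d = d} (right v) =
  R-interior (τ 0) (τ (suc d)) (posᴵ v) (0<τ 0) (0<τ (suc d)) (2τ<1 0) (2τ<1 (suc d)) (posᴵ-interior v)
posᴵ-interior         (diag i)  = diagonal-interior {τ (toℕ i)} (0<τ (toℕ i)) (2τ<1 (toℕ i))

0≤1 : 0ℚ ≤ʳ 1ℚ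
0≤1 = from-yes (0ℚ ℚ.≤? 1ℚ)

0≤α : ∀ {j d} (v : Node j d) → 0ℚ ≤ʳ ⟦ α ⟧ (pos v)
0≤α source    = 0≤1
0≤α sink      = ℚ.≤-refl
0≤α (inner v) = ℚ.<⇒≤ (proj₁ (posᴵ-interior v))

0≤β : ∀ {j d} (v : Node j d) → 0ℚ ≤ʳ ⟦ β ⟧ (pos v)
0≤β source    = ℚ.≤-refl
0≤β sink      = 0≤1
0≤β (inner v) = ℚ.<⇒≤ (proj₁ (proj₂ (posᴵ-interior v)))

0≤γ : ∀ {j d} (v : Node j d) → 0ℚ ≤ʳ ⟦ γ ⟧ (pos v)
0≤γ source    = ℚ.≤-refl
0≤γ sink      = ℚ.≤-refl
0≤γ (inner v) = ℚ.<⇒≤ (proj₂ (proj₂ (posᴵ-interior v)))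

α≡0⇒sink : ∀ {j d} (v : Node j d) → ⟦ α ⟧ (pos v) ≡ 0ℚ → v ≡ sink
α≡0⇒sink source    ()
α≡0⇒sink sink      _  = refl
α≡0⇒sink (inner v) eq = contradiction (proj₁ (posᴵ-interior v)) (ℚ.<-irrefl (sym eq))

β≡0⇒source : ∀ {j d} (v : Node j d) → ⟦ β ⟧ (pos v) ≡ 0ℚ → v ≡ source
β≡0⇒source source    _  = refl
β≡0⇒source sink      ()
β≡0⇒source (inner v) eq = contradiction (proj₁ (proj₂ (posᴵ-interior v))) (ℚ.<-irrefl (sym eq))

γ≢0 : ∀ {j d} (v : Inner j d) → ⟦ γ ⟧ (posᴵ v) ≢ 0ℚ
γ≢0 v eq = contradiction (proj₂ (proj₂ (posᴵ-interior v))) (ℚ.<-irrefl (sym eq))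

δ-left* : ∀ {j d} (v : Node j (suc d)) → ⟦ δ ⟧ (pos (left* v)) ≡ ⟦ α ⟧ (pos v)
δ-left* {d = d} v = subst (λ P → ⟦ δ ⟧ P ≡ ⟦ α ⟧ (pos v)) (sym (pos-left* v)) (δ-L (τ 0) (τ (suc d)) (pos v))

δ-right* : ∀ {j d} (v : Node j (suc d)) → ⟦ neg δ ⟧ (pos (right* v)) ≡ ⟦ β ⟧ (pos v)
δ-right* {d = d} v =
  subst (λ P → ⟦ neg δ ⟧ P ≡ ⟦ β ⟧ (pos v)) (sym (pos-right* v)) (δ-R (τ 0) (τ (suc d)) (pos v))

δ-onDiagonal : ∀ i → ⟦ δ ⟧ (onDiagonal i) ≡ 0ℚ
δ-onDiagonal i = solve 1 (λ p → con 1ℚ :* p :+ con (ℚ.- 1ℚ) :* p :+ con 0ℚ := con 0ℚ) refl (τ i)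

-δ-onDiagonal : ∀ i → ⟦ neg δ ⟧ (onDiagonal i) ≡ 0ℚ
-δ-onDiagonal i = solve 1 (λ p → con (ℚ.- 1ℚ) :* p :+ con 1ℚ :* p :+ con 0ℚ := con 0ℚ) refl (τ i)

left*-diagonal : ∀ {j d} (v : Node j (suc d)) → ⟦ δ ⟧ (pos (left* v)) ≡ 0ℚ → v ≡ sink
left*-diagonal v eq = α≡0⇒sink v (trans (sym (δ-left* v)) eq)

right*-diagonal : ∀ {j d} (v : Node j (suc d)) → ⟦ neg δ ⟧ (pos (right* v)) ≡ 0ℚ → v ≡ source
right*-diagonal v eq = β≡0⇒source v (trans (sym (δ-right* v)) eq)

0≤δ-left* : ∀ {j d} (v : Node j (suc d)) → 0ℚ ≤ʳ ⟦ δ ⟧ (pos (left* v))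
0≤δ-left* v = subst (0ℚ ≤ʳ_) (sym (δ-left* v)) (0≤α v)

0≤-δ-right* : ∀ {j d} (v : Node j (suc d)) → 0ℚ ≤ʳ ⟦ neg δ ⟧ (pos (right* v))
0≤-δ-right* v = subst (0ℚ ≤ʳ_) (sym (δ-right* v)) (0≤β v)

Lᵈ-injective : ∀ d P Q → Lᵈ d P ≡ Lᵈ d Q → P ≡ Q
Lᵈ-injective d P Q = L-injective {τ 0} {τ (suc d)} {P} {Q} (τ₀≢τ₁₊ d)

Rᵈ-injective : ∀ d P Q → Rᵈ d P ≡ Rᵈ d Q → P ≡ Q
Rᵈ-injective d P Q = R-injective {τ 0} {τ (suc d)} {P} {Q} (τ₀≢τ₁₊ d)

diagNode : ∀ {j d} → Fin (suc (suc d)) → Node (suc j) d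
diagNode i = inner (diag i)

diag-diag : ∀ {j d} i k → pos (diagNode {j} {d} i) ≡ pos (diagNode {j} {d} k) → diagNode {j} i ≡ diagNode k
diag-diag i k eq = cong diagNode (toℕ-injective (τ-injective {toℕ i} {toℕ k} (cong proj₁ eq)))

left-diag : ∀ {j d} (u : Node j (suc d)) i → pos (left* u) ≡ pos (diagNode {j} i) → left* u ≡ diagNode i
left-diag u i eq = at-sink (left*-diagonal u (subst (λ P → ⟦ δ ⟧ P ≡ 0ℚ) (sym eq) (δ-onDiagonal (toℕ i))))
  where
  at-sink : u ≡ sink → left* u ≡ diagNode i
  at-sink refl = diag-diag zero i eq

right-diag : ∀ {j d} (u : Node j (suc d)) i → pos (right* u) ≡ pos (diagNode {j} i) → right* u ≡ diagNode i
right-diag u i eq = at-source (right*-diagonal u (subst (λ P → ⟦ neg δ ⟧ P ≡ 0ℚ) (sym eq) (-δ-onDiagonal (toℕ i))))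
  where
  at-source : u ≡ source → right* u ≡ diagNode i
  at-source refl = diag-diag (fromℕ _) i eq

-- `δ` is at least 0 on the left half and at most 0 on the right one, so a shared position has `δ`
-- zero, and the only such node on the left is y.
left-right : ∀ {j d} (u v : Node j (suc d)) → pos (left* u) ≡ pos (right* v) → left* u ≡ right* v
left-right u v eq = at-sink (left*-diagonal u (ℚ.≤-antisym ≤0 (0≤δ-left* u)))
  where
  ≤0 : ⟦ δ ⟧ (pos (left* u)) ≤ʳ 0ℚ
  ≤0 = subst (λ P → ⟦ δ ⟧ P ≤ʳ 0ℚ) (sym eq) (⟦neg⟧-nonPos δ {pos (right* v)} (0≤-δ-right* v))
  at-sink : u ≡ sink → left* u ≡ right* v
  at-sink refl = sym (right-diag v zero (sym eq))

pos-injective : ∀ {j d} {u v : Node j d} → pos u ≡ pos v → u ≡ v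
pos-injective {zero} {u = source} {source} _ = refl
pos-injective {zero} {u = source} {sink} ()
pos-injective {zero} {u = sink} {source} ()
pos-injective {zero} {u = sink} {sink} _ = refl
pos-injective {suc j} {d} {u} {v} = cases (view u) (view v)
  where
  cases : ∀ {u v : Node (suc j) d} → View u → View v → pos u ≡ pos v → u ≡ v
  cases (isLeft u)  (isLeft v)  eq = cong left* (pos-injective (Lᵈ-injective d (pos u) (pos v)
    (trans (sym (pos-left* u)) (trans eq (pos-left* v)))))
  cases (isRight u) (isRight v) eq = cong right* (pos-injective (Rᵈ-injective d (pos u) (pos v)
    (trans (sym (pos-right* u)) (trans eq (pos-right* v)))))
  cases (isLeft u)  (isRight v) eq = left-right u v eq
  cases (isRight u) (isLeft v)  eq = sym (left-right v u (sym eq))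
  cases (isLeft u)  (isDiag i)  eq = left-diag u i eq
  cases (isDiag i)  (isLeft v)  eq = sym (left-diag v i (sym eq))
  cases (isRight u) (isDiag i)  eq = right-diag u i eq
  cases (isDiag i)  (isRight v) eq = sym (right-diag v i (sym eq))
  cases (isDiag i)  (isDiag k)  eq = diag-diag i k eq

-- Links as segments, and where they meet.

_∈ˡ_ : ∀ {j d} → Point → Link j d → Set
r ∈ˡ e = r ∈[ pos (end₁ e) , pos (end₂ e) ]

IsEnd : ∀ {j d} → Link j d → Point → Set
IsEnd e r = r ≡ pos (end₁ e) ⊎ r ≡ pos (end₂ e)

Positive-on : ∀ {j d} → Functional → Link j d → Set
Positive-on f e = NonNegOn f (pos (end₁ e)) (pos (end₂ e))

-- The spoke y-sink is the image under `Rᵈ` of the side apex-sink, where `α` is 0; this keeps the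
-- right half off it. `β` does the same for the left half and the spoke source-z.
positive-α : ∀ {j d} (e : Link j d) → Positive-on α e
positive-α e = nonNegOn (0≤α (end₁ e)) (0≤α (end₂ e))
  λ (z₁ , z₂) → ends-distinct e (trans (α≡0⇒sink (end₁ e) z₁) (sym (α≡0⇒sink (end₂ e) z₂)))

positive-β : ∀ {j d} (e : Link j d) → Positive-on β e
positive-β e = nonNegOn (0≤β (end₁ e)) (0≤β (end₂ e))
  λ (z₁ , z₂) → ends-distinct e (trans (β≡0⇒source (end₁ e) z₁) (sym (β≡0⇒source (end₂ e) z₂)))

left-δ : ∀ {j d} (e : Link j (suc d)) → Positive-on δ (left {j} {d} e)
left-δ e = nonNegOn (0≤δ-left* (end₁ e)) (0≤δ-left* (end₂ e))
  λ (z₁ , z₂) → ends-distinct e (trans (left*-diagonal (end₁ e) z₁) (sym (left*-diagonal (end₂ e) z₂)))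

right-δ : ∀ {j d} (e : Link j (suc d)) → Positive-on (neg δ) (right {j} {d} e)
right-δ e = nonNegOn (0≤-δ-right* (end₁ e)) (0≤-δ-right* (end₂ e))
  λ (z₁ , z₂) → ends-distinct e (trans (right*-diagonal (end₁ e) z₁) (sym (right*-diagonal (end₂ e) z₂)))

spokeˡ-δ : ∀ {j d} → Positive-on δ (spokeˡ {j} {d})
spokeˡ-δ {j} {d} = nonNegOn 0≤1 (ℚ.≤-reflexive (sym (δ-onDiagonal (toℕ (fromℕ (suc d)))))) λ { (() , _) }

spokeʳ-δ : ∀ {j d} → Positive-on (neg δ) (spokeʳ {j} {d})
spokeʳ-δ = nonNegOn (ℚ.≤-reflexive (sym (-δ-onDiagonal 0))) 0≤1 λ { (_ , ()) }

pullˡ : ∀ d P Q {r} → r ∈[ Lᵈ d P , Lᵈ d Q ] → ∃[ s ] s ∈[ P , Q ] × r ≡ Lᵈ d s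
pullˡ d P Q (_at_ {t} t∈ eq) = along P Q t , (t∈ at refl) , trans (sym eq) (sym (L-along (τ 0) (τ (suc d)) P Q t))

pullʳ : ∀ d P Q {r} → r ∈[ Rᵈ d P , Rᵈ d Q ] → ∃[ s ] s ∈[ P , Q ] × r ≡ Rᵈ d s
pullʳ d P Q (_at_ {t} t∈ eq) = along P Q t , (t∈ at refl) , trans (sym eq) (sym (R-along (τ 0) (τ (suc d)) P Q t))

apex : Point
apex = 0ℚ , 0ℚ

pull-left : ∀ {j d} (e : Link j (suc d)) {r} → r ∈ˡ left {j} {d} e → ∃[ s ] s ∈ˡ e × r ≡ Lᵈ d s
pull-left {d = d} e {r} r∈ = pullˡ d (pos (end₁ e)) (pos (end₂ e))
  (subst₂ (λ P Q → r ∈[ P , Q ]) (pos-left* (end₁ e)) (pos-left* (end₂ e)) r∈)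

pull-right : ∀ {j d} (e : Link j (suc d)) {r} → r ∈ˡ right {j} {d} e → ∃[ s ] s ∈ˡ e × r ≡ Rᵈ d s
pull-right {d = d} e {r} r∈ = pullʳ d (pos (end₁ e)) (pos (end₂ e))
  (subst₂ (λ P Q → r ∈[ P , Q ]) (pos-right* (end₁ e)) (pos-right* (end₂ e)) r∈)

-- `Lᵈ` sends the apex to z, so the spoke is the image of the side source-apex, on which `β` is 0.
pull-spokeˡ : ∀ {j d r} → r ∈ˡ spokeˡ {j} {d} → ∃[ s ] ⟦ β ⟧ s ≤ʳ 0ℚ × r ≡ Lᵈ d s
pull-spokeˡ {j} {d} {r} r∈ =
  let s , s∈ , eq = pullˡ d (1ℚ , 0ℚ) apex
        (subst₂ (λ P Q → r ∈[ P , Q ]) (sym (L-source (τ 0) (τ (suc d))))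
          (trans (pos-right*-source {j} {d}) (sym (L-apex (τ 0) (τ (suc d))))) r∈)
  in s , ⟦neg⟧-nonPos β {s} (nonNeg-at (neg β) {1ℚ , 0ℚ} {apex} {s} ℚ.≤-refl ℚ.≤-refl s∈) , eq

pull-spokeʳ : ∀ {j d r} → r ∈ˡ spokeʳ {j} {d} → ∃[ s ] ⟦ α ⟧ s ≤ʳ 0ℚ × r ≡ Rᵈ d s
pull-spokeʳ {j} {d} {r} r∈ =
  let s , s∈ , eq = pullʳ d apex (0ℚ , 1ℚ)
        (subst₂ (λ P Q → r ∈[ P , Q ]) (sym (cong ×.swap (L-apex (τ (suc d)) (τ 0))))
          (sym (cong ×.swap (L-source (τ (suc d)) (τ 0)))) r∈)
  in s , ⟦neg⟧-nonPos α {s} (nonNeg-at (neg α) {apex} {0ℚ , 1ℚ} {s} ℚ.≤-refl ℚ.≤-refl s∈) , eq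

push-left : ∀ {j d} (e : Link j (suc d)) {r s} → r ≡ Lᵈ d s → IsEnd e s → IsEnd (left {j} {d} e) r
push-left e r≡ (inj₁ refl) = inj₁ (trans r≡ (sym (pos-left* (end₁ e))))
push-left e r≡ (inj₂ refl) = inj₂ (trans r≡ (sym (pos-left* (end₂ e))))

push-right : ∀ {j d} (e : Link j (suc d)) {r s} → r ≡ Rᵈ d s → IsEnd e s → IsEnd (right {j} {d} e) r
push-right e r≡ (inj₁ refl) = inj₁ (trans r≡ (sym (pos-right* (end₁ e))))
push-right e r≡ (inj₂ refl) = inj₂ (trans r≡ (sym (pos-right* (end₂ e))))

-- The links of the y-z path are collinear, so `δ` cannot separate them; a vertical line through a
-- common corner does.
beyond : ℚ → Functional
beyond c = 1ℚ , 0ℚ , ℚ.- c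

beyond-onDiagonal : ∀ c k → ⟦ beyond c ⟧ (onDiagonal k) ≡ τ k -ʳ c
beyond-onDiagonal c k =
  solve 2 (λ c p → con 1ℚ :* p :+ con 0ℚ :* p :+ (:- c) := p :- c) refl c (τ k)

-beyond-onDiagonal : ∀ c k → ⟦ neg (beyond c) ⟧ (onDiagonal k) ≡ c -ʳ τ k
-beyond-onDiagonal c k =
  solve 2 (λ c p → con (ℚ.- 1ℚ) :* p :+ con (ℚ.- 0ℚ) :* p :+ (:- (:- c)) := c :- p) refl c (τ k)

0≤beyond : ∀ {i k} → i ℕ.≤ k → 0ℚ ≤ʳ ⟦ beyond (τ k) ⟧ (onDiagonal i)
0≤beyond {i} {k} i≤k = subst (0ℚ ≤ʳ_) (sym (beyond-onDiagonal (τ k) i)) (≤⇒0≤- {τ k} {τ i} (τ-antitone i≤k))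

0≤-beyond : ∀ {i k} → i ℕ.≤ k → 0ℚ ≤ʳ ⟦ neg (beyond (τ i)) ⟧ (onDiagonal k)
0≤-beyond {i} {k} i≤k = subst (0ℚ ≤ʳ_) (sym (-beyond-onDiagonal (τ i) k)) (≤⇒0≤- {τ k} {τ i} (τ-antitone i≤k))

diag-beyond : ∀ i → NonNegOn (beyond (τ (suc i))) (onDiagonal i) (onDiagonal (suc i))
diag-beyond i = nonNegOn (0≤beyond {i} {suc i} (ℕ.n≤1+n i)) (0≤beyond {suc i} {suc i} ℕ.≤-refl)
  λ (z , _) → ℕ.1+n≢n (sym (τ-injective {i} {suc i}
    (p-q≡0⇒p≡q {τ i} {τ (suc i)} (trans (sym (beyond-onDiagonal (τ (suc i)) i)) z))))

diag-before : ∀ i → NonNegOn (neg (beyond (τ i))) (onDiagonal i) (onDiagonal (suc i))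
diag-before i = nonNegOn (0≤-beyond {i} {i} ℕ.≤-refl) (0≤-beyond {i} {suc i} (ℕ.n≤1+n i))
  λ (_ , z) → ℕ.1+n≢n (sym (τ-injective {i} {suc i}
    (p-q≡0⇒p≡q {τ i} {τ (suc i)} (trans (sym (-beyond-onDiagonal (τ i) (suc i))) z))))

_∈ᵈ_ : ∀ {n} → Point → Fin n → Set
r ∈ᵈ i = r ∈[ onDiagonal (toℕ (inject₁ i)) , onDiagonal (suc (toℕ i)) ]

diag-ends : ∀ {n} (i : Fin n) {r} → r ∈ᵈ i → r ∈[ onDiagonal (toℕ i) , onDiagonal (suc (toℕ i)) ]
diag-ends i {r} = subst (λ k → r ∈[ onDiagonal k , onDiagonal (suc (toℕ i)) ]) (toℕ-inject₁ i)

diag-end : ∀ {n} (i : Fin n) {r} → r ≡ onDiagonal (toℕ i) ⊎ r ≡ onDiagonal (suc (toℕ i)) →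
           r ≡ onDiagonal (toℕ (inject₁ i)) ⊎ r ≡ onDiagonal (suc (toℕ i))
diag-end i = ⊎.map₁ (λ eq → trans eq (cong onDiagonal (sym (toℕ-inject₁ i))))

diag-0≤δ : ∀ {n} (i : Fin n) {r} → r ∈ᵈ i → 0ℚ ≤ʳ ⟦ δ ⟧ r
diag-0≤δ i = nonNeg-at δ (ℚ.≤-reflexive (sym (δ-onDiagonal (toℕ (inject₁ i)))))
                         (ℚ.≤-reflexive (sym (δ-onDiagonal (suc (toℕ i)))))

diag-δ≤0 : ∀ {n} (i : Fin n) {r} → r ∈ᵈ i → ⟦ δ ⟧ r ≤ʳ 0ℚ
diag-δ≤0 i {r} r∈ = ⟦neg⟧-nonPos δ {r}
  (nonNeg-at (neg δ) (ℚ.≤-reflexive (sym (-δ-onDiagonal (toℕ (inject₁ i)))))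
                     (ℚ.≤-reflexive (sym (-δ-onDiagonal (suc (toℕ i))))) r∈)

-- The symmetric form allows an end of either link; `meet` later turns an end of the second into one
-- of the first.
record NoCrossing {j d} (e f : Link j d) : Set where
  constructor uncrossed
  field at-ends : ∀ {r} → r ∈ˡ e → r ∈ˡ f → IsEnd e r ⊎ IsEnd f r

NoCrossing-sym : ∀ {j d} {e f : Link j d} → NoCrossing e f → NoCrossing f e
NoCrossing-sym nc = uncrossed λ r∈f r∈e → ⊎.swap (NoCrossing.at-ends nc r∈e r∈f)

-- The spoke source-z counts as left because it runs on the side where `δ` is nonnegative; likewise
-- the spoke y-sink on the right.
data LeftHalf {j d} : Link (suc j) d → Set where
  link  : ∀ e → LeftHalf (left e)
  spoke : LeftHalf spokeˡ

data RightHalf {j d} : Link (suc j) d → Set where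
  link  : ∀ e → RightHalf (right e)
  spoke : RightHalf spokeʳ

data Side {j d} : Link (suc j) d → Set where
  isLeft  : ∀ {e} → LeftHalf e → Side e
  isRight : ∀ {e} → RightHalf e → Side e
  isDiag  : ∀ i → Side (diag i)

side : ∀ {j d} (e : Link (suc j) d) → Side e
side (left e)  = isLeft (link e)
side (right e) = isRight (link e)
side spokeˡ    = isLeft spoke
side spokeʳ    = isRight spoke
side (diag i)  = isDiag i

positive-δ : ∀ {j d} {e : Link (suc j) d} → LeftHalf e → Positive-on δ e
positive-δ         (link e) = left-δ e
positive-δ {j} {d} spoke    = spokeˡ-δ {j} {d}

negative-δ : ∀ {j d} {e : Link (suc j) d} → RightHalf e → Positive-on (neg δ) e
negative-δ         (link e) = right-δ e
negative-δ {j} {d} spoke    = spokeʳ-δ {j} {d}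

left-vs-right : ∀ {j d} {e f : Link (suc j) d} → LeftHalf e → RightHalf f → NoCrossing e f
left-vs-right {e = e} {f} l r =
  let nonNegOn 0≤₁ 0≤₂ _ = negative-δ r
  in uncrossed λ r∈e r∈f → inj₁ (separate δ (positive-δ l) 0≤₁ 0≤₂ r∈e r∈f)

left-vs-diag : ∀ {j d} {e : Link (suc j) d} → LeftHalf e → ∀ i → NoCrossing e (diag i)
left-vs-diag l i = uncrossed λ r∈e r∈i → inj₁ (touch δ (positive-δ l) r∈e (diag-δ≤0 i r∈i))

right-vs-diag : ∀ {j d} {e : Link (suc j) d} → RightHalf e → ∀ i → NoCrossing e (diag i)
right-vs-diag l i = uncrossed λ {r} r∈e r∈i → inj₁ (touch (neg δ) (negative-δ l) r∈e (⟦neg⟧≤0 δ r (diag-0≤δ i r∈i)))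

diag-vs-diag : ∀ {j d} {i k : Fin (suc d)} → toℕ i ℕ.< toℕ k → NoCrossing {suc j} (diag i) (diag k)
diag-vs-diag {i = i} {k} i<k = uncrossed λ r∈i r∈k → inj₁ (diag-end i
  (separate (beyond (τ (suc (toℕ i)))) (diag-beyond (toℕ i))
    (0≤-beyond {suc (toℕ i)} {toℕ k} i<k) (0≤-beyond {suc (toℕ i)} {suc (toℕ k)} (ℕ.m≤n⇒m≤1+n i<k))
    (diag-ends i r∈i) (diag-ends k r∈k)))

-- A common point has one preimage under the injective affine map, lying on both original links.
left-vs-left : ∀ {j d} {e f : Link j (suc d)} → NoCrossing e f → NoCrossing (left {j} {d} e) (left f)
left-vs-left {d = d} {e} {f} nc = uncrossed λ r∈e r∈f →
  let s , s∈ , r≡ = pull-left e r∈e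
      s′ , s′∈ , r≡′ = pull-left f r∈f
      s≡s′ = Lᵈ-injective d s s′ (trans (sym r≡) r≡′)
  in ⊎.map (push-left e r≡) (push-left f r≡) (NoCrossing.at-ends nc s∈ (subst (_∈ˡ f) (sym s≡s′) s′∈))

right-vs-right : ∀ {j d} {e f : Link j (suc d)} → NoCrossing e f → NoCrossing (right {j} {d} e) (right f)
right-vs-right {d = d} {e} {f} nc = uncrossed λ r∈e r∈f →
  let s , s∈ , r≡ = pull-right e r∈e
      s′ , s′∈ , r≡′ = pull-right f r∈f
      s≡s′ = Rᵈ-injective d s s′ (trans (sym r≡) r≡′)
  in ⊎.map (push-right e r≡) (push-right f r≡) (NoCrossing.at-ends nc s∈ (subst (_∈ˡ f) (sym s≡s′) s′∈))

left-vs-spokeˡ : ∀ {j d} (e : Link j (suc d)) → NoCrossing (left {j} {d} e) spokeˡ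
left-vs-spokeˡ {j} {d} e = uncrossed λ r∈e r∈ˡ →
  let s , s∈ , r≡ = pull-left e r∈e
      s′ , β≤0 , r≡′ = pull-spokeˡ {j} {d} r∈ˡ
      s≡s′ = Lᵈ-injective d s s′ (trans (sym r≡) r≡′)
  in inj₁ (push-left e r≡ (touch β (positive-β e) s∈ (subst (λ s → ⟦ β ⟧ s ≤ʳ 0ℚ) (sym s≡s′) β≤0)))

right-vs-spokeʳ : ∀ {j d} (e : Link j (suc d)) → NoCrossing (right {j} {d} e) spokeʳ
right-vs-spokeʳ {j} {d} e = uncrossed λ r∈e r∈ʳ →
  let s , s∈ , r≡ = pull-right e r∈e
      s′ , α≤0 , r≡′ = pull-spokeʳ {j} {d} r∈ʳ
      s≡s′ = Rᵈ-injective d s s′ (trans (sym r≡) r≡′)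
  in inj₁ (push-right e r≡ (touch α (positive-α e) s∈ (subst (λ s → ⟦ α ⟧ s ≤ʳ 0ℚ) (sym s≡s′) α≤0)))

-- The sign of `δ` separates left, right and the y-z path. Inside a half, links are pulled back to
-- the smaller network, and the spoke is a side of its triangle.
noCrossing : ∀ {j d} (e f : Link j d) → e ≢ f → NoCrossing e f
noCrossing base base e≢f = contradiction refl e≢f
noCrossing {suc j} {d} e f = cases (side e) (side f)
  where
  lefts : ∀ {e f : Link (suc j) d} → LeftHalf e → LeftHalf f → e ≢ f → NoCrossing e f
  lefts (link e) (link f) e≢f = left-vs-left (noCrossing e f (e≢f ∘ cong left))
  lefts (link e) spoke    _   = left-vs-spokeˡ e
  lefts spoke    (link f) _   = NoCrossing-sym (left-vs-spokeˡ f)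
  lefts spoke    spoke    e≢f = contradiction refl e≢f

  rights : ∀ {e f : Link (suc j) d} → RightHalf e → RightHalf f → e ≢ f → NoCrossing e f
  rights (link e) (link f) e≢f = right-vs-right (noCrossing e f (e≢f ∘ cong right))
  rights (link e) spoke    _   = right-vs-spokeʳ e
  rights spoke    (link f) _   = NoCrossing-sym (right-vs-spokeʳ f)
  rights spoke    spoke    e≢f = contradiction refl e≢f

  cases : ∀ {e f : Link (suc j) d} → Side e → Side f → e ≢ f → NoCrossing e f
  cases (isLeft l)  (isLeft l′)  e≢f = lefts l l′ e≢f
  cases (isRight r) (isRight r′) e≢f = rights r r′ e≢f
  cases (isLeft l)  (isRight r)  _   = left-vs-right l r
  cases (isRight r) (isLeft l)   _   = NoCrossing-sym (left-vs-right l r)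
  cases (isLeft l)  (isDiag i)   _   = left-vs-diag l i
  cases (isDiag i)  (isLeft l)   _   = NoCrossing-sym (left-vs-diag l i)
  cases (isRight r) (isDiag i)   _   = right-vs-diag r i
  cases (isDiag i)  (isRight r)  _   = NoCrossing-sym (right-vs-diag r i)
  cases (isDiag i)  (isDiag k)   i≢k with ℕ.<-cmp (toℕ i) (toℕ k)
  ... | tri< i<k _ _ = diag-vs-diag i<k
  ... | tri≈ _ i≡k _ = contradiction (cong diag (toℕ-injective i≡k)) i≢k
  ... | tri> _ _ k<i = NoCrossing-sym (diag-vs-diag k<i)

pos∈⇒end : ∀ {j d} (v : Node j d) (e : Link j d) → pos v ∈ˡ e → v ≡ end₁ e ⊎ v ≡ end₂ e
pos∈⇒end source base _ = inj₁ refl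
pos∈⇒end sink   base _ = inj₂ refl
pos∈⇒end {suc j} {d} v e = cases (view v) (side e)
  where
  node-end : ∀ {v} {e : Link (suc j) d} → IsEnd e (pos v) → v ≡ end₁ e ⊎ v ≡ end₂ e
  node-end = ⊎.map pos-injective pos-injective

  diags : ∀ k i → pos (inner (diag {j} k)) ∈ˡ diag {j} i → IsEnd (diag {j} {d} i) (pos (inner (diag {j} k)))
  diags k i k∈ with ℕ.≤-<-connex (toℕ k) (toℕ i)
  ... | inj₁ k≤i = diag-end i (touch (neg (beyond (τ (toℕ i)))) (diag-before (toℕ i)) (diag-ends i k∈)
                     (⟦neg⟧≤0 (beyond (τ (toℕ i))) (onDiagonal (toℕ k)) (0≤beyond {toℕ k} {toℕ i} k≤i)))
  ... | inj₂ i<k = diag-end i (touch (beyond (τ (suc (toℕ i)))) (diag-beyond (toℕ i)) (diag-ends i k∈)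
                     (⟦neg⟧-nonPos (beyond (τ (suc (toℕ i)))) {onDiagonal (toℕ k)} (0≤-beyond {suc (toℕ i)} {toℕ k} i<k)))

  cases : ∀ {v e} → View v → Side e → pos v ∈ˡ e → v ≡ end₁ e ⊎ v ≡ end₂ e
  cases (isLeft v) (isLeft (link e)) v∈ =
    let s , s∈ , v≡ = pull-left {j} {d} e v∈
        s≡ = Lᵈ-injective d s (pos v) (trans (sym v≡) (pos-left* v))
    in ⊎.map (cong left*) (cong left*) (pos∈⇒end v e (subst (_∈ˡ e) s≡ s∈))
  cases (isRight v) (isRight (link e)) v∈ =
    let s , s∈ , v≡ = pull-right {j} {d} e v∈
        s≡ = Rᵈ-injective d s (pos v) (trans (sym v≡) (pos-right* v))
    in ⊎.map (cong right*) (cong right*) (pos∈⇒end v e (subst (_∈ˡ e) s≡ s∈))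
  cases (isLeft v) (isLeft spoke) v∈ =
    let s , β≤0 , v≡ = pull-spokeˡ {j} {d} v∈
        s≡ = Lᵈ-injective d s (pos v) (trans (sym v≡) (pos-left* v))
    in inj₁ (cong left* (β≡0⇒source v (ℚ.≤-antisym (subst (λ s → ⟦ β ⟧ s ≤ʳ 0ℚ) s≡ β≤0) (0≤β v))))
  cases (isRight v) (isRight spoke) v∈ =
    let s , α≤0 , v≡ = pull-spokeʳ {j} {d} v∈
        s≡ = Rᵈ-injective d s (pos v) (trans (sym v≡) (pos-right* v))
    in inj₂ (cong right* (α≡0⇒sink v (ℚ.≤-antisym (subst (λ s → ⟦ α ⟧ s ≤ʳ 0ℚ) s≡ α≤0) (0≤α v))))
  cases (isLeft v) (isRight {e} r) v∈ =
    node-end {e = e} (touch (neg δ) (negative-δ r) v∈ (⟦neg⟧≤0 δ (pos (left* v)) (0≤δ-left* v)))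
  cases (isRight v) (isLeft {e} l) v∈ =
    node-end {e = e} (touch δ (positive-δ l) v∈ (⟦neg⟧-nonPos δ {pos (right* v)} (0≤-δ-right* v)))
  -- A left node on the y-z line is y, which is also the first node of the path, so the comparison
  -- along the path applies.
  cases (isLeft v) (isDiag i) v∈ = node-end {e = diag i}
    (at-sink (left*-diagonal v (ℚ.≤-antisym (diag-δ≤0 i v∈) (0≤δ-left* v))) v∈)
    where
    at-sink : v ≡ sink → pos (left* v) ∈ˡ diag {j} i → IsEnd (diag {j} i) (pos (left* v))
    at-sink refl = diags zero i
  cases (isRight v) (isDiag i) v∈ = node-end {e = diag i}
    (at-source (right*-diagonal v (ℚ.≤-antisym (⟦neg⟧≤0 δ (pos (right* v)) (diag-0≤δ i v∈)) (0≤-δ-right* v))) v∈)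
    where
    at-source : v ≡ source → pos (right* v) ∈ˡ diag {j} i → IsEnd (diag {j} i) (pos (right* v))
    at-source refl = diags (fromℕ (suc d)) i
  cases (isDiag k) (isDiag i) v∈ = node-end {e = diag i} (diags k i v∈)
  cases (isDiag k) (isLeft {e} l)  v∈ =
    node-end {e = e} (touch δ (positive-δ l) v∈ (ℚ.≤-reflexive (δ-onDiagonal (toℕ k))))
  cases (isDiag k) (isRight {e} r) v∈ =
    node-end {e = e} (touch (neg δ) (negative-δ r) v∈ (ℚ.≤-reflexive (-δ-onDiagonal (toℕ k))))

-- The plane drawing of the closed network.

_∈ᵇ_ : ∀ {i} → Point → Bond i → Set
r ∈ᵇ b = r ∈[ pos (bond₁ b) , pos (bond₂ b) ]

IsBondEnd : ∀ {i} → Bond i → Point → Set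
IsBondEnd b r = r ≡ pos (bond₁ b) ⊎ r ≡ pos (bond₂ b)

HasInner : ∀ {j d} → Link j d → Set
HasInner e = (∃[ v ] end₁ e ≡ inner v) ⊎ (∃[ v ] end₂ e ≡ inner v)

-- Once there are at least two inside colours, no link joins the poles directly; thus none lies
-- along the closing edge.
hasInner : ∀ {j d} (e : Link (suc j) d) → HasInner e
hasInner         (left base)  = inj₂ (_ , refl)
hasInner {suc _} (left e)     = ⊎.map lift lift (hasInner e)
  where
  lift : ∀ {u} → ∃[ v ] u ≡ inner v → ∃[ v ] left* u ≡ inner v
  lift (v , eq) = left v , cong left* eq
hasInner         (right base) = inj₁ (_ , refl)
hasInner {suc _} (right e)    = ⊎.map lift lift (hasInner e)
  where
  lift : ∀ {u} → ∃[ v ] u ≡ inner v → ∃[ v ] right* u ≡ inner v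
  lift (v , eq) = right v , cong right* eq
hasInner         spokeˡ       = inj₂ (_ , refl)
hasInner         spokeʳ       = inj₁ (_ , refl)
hasInner         (diag i)     = inj₂ (_ , refl)

-- `γ` is 0 along the closing edge and positive at inner nodes, so it separates every link from that
-- edge.
positive-γ : ∀ {j d} (e : Link (suc j) d) → Positive-on γ e
positive-γ e = nonNegOn (0≤γ (end₁ e)) (0≤γ (end₂ e)) (¬both (hasInner e))
  where
  ¬both : HasInner e → ¬ (⟦ γ ⟧ (pos (end₁ e)) ≡ 0ℚ × ⟦ γ ⟧ (pos (end₂ e)) ≡ 0ℚ)
  ¬both (inj₁ (v , eq)) (z , _) = γ≢0 v (subst (λ u → ⟦ γ ⟧ (pos u) ≡ 0ℚ) eq z)
  ¬both (inj₂ (v , eq)) (_ , z) = γ≢0 v (subst (λ u → ⟦ γ ⟧ (pos u) ≡ 0ℚ) eq z)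

γ≡0⇒pole : ∀ {j d} (v : Node j d) → ⟦ γ ⟧ (pos v) ≡ 0ℚ → v ≡ source ⊎ v ≡ sink
γ≡0⇒pole source    _ = inj₁ refl
γ≡0⇒pole sink      _ = inj₂ refl
γ≡0⇒pole (inner v) z = contradiction z (γ≢0 v)

module _ {i : ℕ} where

  closing-γ≤0 : ∀ {r} → r ∈[ (1ℚ , 0ℚ) , (0ℚ , 1ℚ) ] → ⟦ γ ⟧ r ≤ʳ 0ℚ
  closing-γ≤0 {r} r∈ = ⟦neg⟧-nonPos γ {r} (nonNeg-at (neg γ) ℚ.≤-refl ℚ.≤-refl r∈)

  bonds-noCrossing : (b c : Bond i) → b ≢ c → ∀ {r} → r ∈ᵇ b → r ∈ᵇ c → IsBondEnd b r ⊎ IsBondEnd c r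
  bonds-noCrossing (just e) (just f) e≢f r∈e r∈f = NoCrossing.at-ends (noCrossing e f (e≢f ∘ cong just)) r∈e r∈f
  bonds-noCrossing (just e) nothing  _   r∈e r∈f = inj₁ (touch γ (positive-γ e) r∈e (closing-γ≤0 r∈f))
  bonds-noCrossing nothing  (just f) _   r∈e r∈f = inj₂ (touch γ (positive-γ f) r∈f (closing-γ≤0 r∈e))
  bonds-noCrossing nothing  nothing  e≢e _   _   = contradiction refl e≢e

  pos∈ᵇ⇒end : ∀ v (b : Bond i) → pos v ∈ᵇ b → v ≡ bond₁ b ⊎ v ≡ bond₂ b
  pos∈ᵇ⇒end v (just e) v∈ = pos∈⇒end v e v∈
  pos∈ᵇ⇒end v nothing  v∈ = γ≡0⇒pole v (ℚ.≤-antisym (closing-γ≤0 v∈) (0≤γ v))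

  private
    link-of : Edge (G i) → Bond i
    link-of e = proj₁ (Edge.adj e)

    src tgt : Edge (G i) → Node (suc i) 0
    src = node i ∘ Edge.src
    tgt = node i ∘ Edge.tgt

    ends : ∀ e → Joins (link-of e) (src e) (tgt e)
    ends e = proj₂ (Edge.adj e)

    src≢tgt : ∀ e → pos (src e) ≢ pos (tgt e)
    src≢tgt e eq = Graph.irrefl (G i) (node-injective i (pos-injective eq)) (Edge.adj e)

    to-bond : ∀ e {r} → r ∈[ pos (src e) , pos (tgt e) ] → r ∈ᵇ link-of e
    to-bond e {r} r∈ with ends e
    ... | inj₁ (p , q) = subst₂ (λ u v → r ∈[ pos u , pos v ]) p q r∈
    ... | inj₂ (p , q) = segment-sym (subst₂ (λ u v → r ∈[ pos u , pos v ]) p q r∈)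

    from-end : ∀ e {v} → v ≡ bond₁ (link-of e) ⊎ v ≡ bond₂ (link-of e) → v ≡ src e ⊎ v ≡ tgt e
    from-end e v≡ with ends e
    ... | inj₁ (p , q) = ⊎.map (λ eq → trans eq (sym p)) (λ eq → trans eq (sym q)) v≡
    ... | inj₂ (p , q) = ⊎.swap (⊎.map (λ eq → trans eq (sym q)) (λ eq → trans eq (sym p)) v≡)

    joins-unique : ∀ (b : Bond i) {u v u′ v′} → Joins b u v → Joins b u′ v′ → (u ≡ u′ × v ≡ v′) ⊎ (u ≡ v′ × v ≡ u′)
    joins-unique _ (inj₁ (p , q)) (inj₁ (p′ , q′)) = inj₁ (trans p (sym p′) , trans q (sym q′))
    joins-unique _ (inj₁ (p , q)) (inj₂ (p′ , q′)) = inj₂ (trans p (sym q′) , trans q (sym p′))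
    joins-unique _ (inj₂ (p , q)) (inj₁ (p′ , q′)) = inj₂ (trans p (sym q′) , trans q (sym p′))
    joins-unique _ (inj₂ (p , q)) (inj₂ (p′ , q′)) = inj₁ (trans p (sym p′) , trans q (sym q′))

    -- A bond fixes its two ends up to order, and `ordered` excludes the reversed case. Edges with
    -- different ends therefore have different bonds.
    same-ends : ∀ e f → link-of e ≡ link-of f → Edge.src e ≡ Edge.src f × Edge.tgt e ≡ Edge.tgt f
    same-ends e f eq with joins-unique (link-of e) (ends e) (subst (λ b → Joins b (src f) (tgt f)) (sym eq) (ends f))
    ... | inj₁ (p , q) = node-injective i p , node-injective i q
    ... | inj₂ (p , q) = contradiction (Edge.ordered f)
      (Fin.<-asym (subst₂ Fin._<_ (node-injective i p) (node-injective i q) (Edge.ordered e)))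

    unbend : ∀ e {r} → r ∈ᵃ segment (src≢tgt e) → r ∈[ pos (src e) , pos (tgt e) ]
    unbend e (zero , t , t∈ , eq) = t∈ at eq

    vertex-on-edge : ∀ e v → pos v ∈ᵃ segment (src≢tgt e) → v ≡ src e ⊎ v ≡ tgt e
    vertex-on-edge e v v∈ = from-end e (pos∈ᵇ⇒end v (link-of e) (to-bond e (unbend e v∈)))

    meet : ∀ e f → ¬ (Edge.src e ≡ Edge.src f × Edge.tgt e ≡ Edge.tgt f) →
           ∀ r → r ∈ᵃ segment (src≢tgt e) → r ∈ᵃ segment (src≢tgt f) → r ≡ pos (src e) ⊎ r ≡ pos (tgt e)
    meet e f e≢f r r∈e r∈f
      with bonds-noCrossing (link-of e) (link-of f) (e≢f ∘ same-ends e f)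
             (to-bond e (unbend e r∈e)) (to-bond f (unbend f r∈f))
    ... | inj₁ r-end = at-end r-end
      where
      at-end : IsBondEnd (link-of e) r → r ≡ pos (src e) ⊎ r ≡ pos (tgt e)
      at-end (inj₁ refl) = ⊎.map (cong pos) (cong pos) (from-end e (inj₁ refl))
      at-end (inj₂ refl) = ⊎.map (cong pos) (cong pos) (from-end e (inj₂ refl))
    -- An end of `f` on `e` is a vertex on `e`, hence an end of `e`.
    ... | inj₂ r-end = at-end r-end r∈e
      where
      at-end : IsBondEnd (link-of f) r → r ∈ᵃ segment (src≢tgt e) → r ≡ pos (src e) ⊎ r ≡ pos (tgt e)
      at-end (inj₁ refl) = ⊎.map (cong pos) (cong pos) ∘ vertex-on-edge e (bond₁ (link-of f))
      at-end (inj₂ refl) = ⊎.map (cong pos) (cong pos) ∘ vertex-on-edge e (bond₂ (link-of f))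

  planar : Planar (G i)
  planar = record
    { pos         = pos ∘ node i
    ; pos-inj     = node-injective i ∘ pos-injective
    ; arc         = λ e → segment (src≢tgt e)
    ; edge-vertex = λ e v v∈ → ⊎.map (node-injective i) (node-injective i) (vertex-on-edge e (node i v) v∈)
    ; edge-edge   = meet
    }

-- Assembling the theorem.

whole : ∀ i → Embedding (G i) (suc i) 0
-- For `d = 0` the outside path is the closing edge alone.
whole i = record { φ = code i ; adj = link-adj i ; outer = closing-adj i ∷ [] }

clique : ∀ q → ∃[ w ] IsCliqueNumber (walkPower (G (2 * q)) (1 + 2 * q)) w × w ≥ 2 ^ (2 + 2 * q)
clique q =
  let S , ∣S∣≡ , S⊆ = image f (terminal-injective ∘ code-injective i)
      w , number , w≥ = cliqueNumber (walkPower (G i) (1 + i)) S λ x y x∈S y∈S x≢y →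
        x≢y , walk (S⊆ x∈S) (S⊆ y∈S) x≢y
  in w , number , subst (w ≥_) ∣S∣≡ w≥
  where
  i : ℕ
  i = 2 * q
  f : Vec Bool (2 + i) → Graph.Vertex (G i)
  f = code i ∘ terminal
  walk : ∀ {x y} → ∃[ A ] x ≡ f A → ∃[ B ] y ≡ f B → x ≢ y → Walk (G i) (1 + i) x y
  walk (A , refl) (B , refl) fA≢fB = Short⇒Walk (G i) fA≢fB
    (terminals-short (G i) (whole i) q (cong suc (ℕ.+-identityʳ i)) A B (fA≢fB ∘ cong f))

odd-2k+1 : ∀ k → Odd (2 * k + 1)
odd-2k+1 k 2∣ with ∣1⇒≡1 (∣m+n∣m⇒∣n 2∣ (m∣m*n k))
... | ()

oddGirth : ∀ i k → 3 + i ≡ 2 * k + 1 → IsOddGirth (G i) (2 * k + 1)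
oddGirth i k eq = odd-2k+1 k , subst (Cycle (G i)) eq (ladder-cycle i) ,
  λ l odd c → subst (_≤ l) eq (odd-cycle-length i l odd c)

theorem4 : (k : ℕ) → 1 ≤ k →
    Σ[ G ∈ Graph ]
    ( Planar G
    × IsOddGirth G (2 * k + 1)
    × (∃[ ω ] IsCliqueNumber (walkPower G (2 * k ∸ 1)) ω × ω ≥ 2 ^ (2 * k)) )
theorem4 (suc q) _ =
  -- For `k = q + 1` the network has `2 + 2 * q` inside colours, and the closing edge accounts for
  -- the last of the `2 * k + 1`.
  G (2 * q) , planar ,
  oddGirth (2 * q) (suc q) (trans (cong suc (sym (ℕ.*-suc 2 q))) (ℕ.+-comm 1 (2 * suc q))) ,
  -- At `n = 2 + 2 * q` the truncated `n ∸ 1` computes to `1 + 2 * q`, the exponent used in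
  -- `clique`.
  subst (λ n → ∃[ ω ] IsCliqueNumber (walkPower (G (2 * q)) (n ∸ 1)) ω × ω ≥ 2 ^ n) (sym (ℕ.*-suc 2 q)) (clique q)
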